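{- Let $M$ be a matroid on an $n$-element set and let $x$ be an element not in that set. The $\mathcal{G}$-invariant of the free extension $M+x$ is obtained from $\mathcal{G}(M)$ by the specialization $$[r_1r_2\ldots r_n]\mapsto[1r_1r_2\ldots r_n]^{\downarrow}+\sum_{j=1}^n[r_1\ldots r_j\,1\,r_{j+1}\ldots r_n]^{\downarrow},$$ and the $\mathcal{G}$-invariant of the free coextension $M\times x$ is obtained from $\mathcal{G}(M)$ by the specialization $$[r_1r_2\ldots r_n]\mapsto[0r_1r_2\ldots r_n]^{\uparrow}+\sum_{j=1}^n[r_1\ldots r_j\,0\,r_{j+1}\ldots r_n]^{\uparrow}.$$
   Context: An $(n,r)$-sequence is a $0,1$-sequence of length $n$ with exactly $r$ ones. $\mathcal{G}(n,r)$ is the vector space over a field of characteristic zero with basis the formal symbols $[\underline{r}]$, one for each $(n,r)$-sequence $\underline{r}$. For a rank-$r$ matroid $M$ with rank function $r(\cdot)$ on an $n$-element set $E$, and a permutation (linear ordering) $\pi$ of $E$, the rank sequence $\underline{r}(\pi)=r_1r_2\ldots r_n$ is given by $r_1=r(\{\pi(1)\})$ and $r_j=r(\{\pi(1),\ldots,\pi(j)\})-r(\{\pi(1),\ldots,\pi(j-1)\})$ for $j\ge2$. The $\mathcal{G}$-invariant is $\mathcal{G}(M)=\sum_{\pi}[\underline{r}(\pi)]\in\mathcal{G}(n,r)$, the sum over all $n!$ permutations of $E$. A specialization is an assignment of a value to each symbol $[\underline{r}]$, extended linearly to $\mathcal{G}(n,r)$; "obtained by the specialization" means applying this linear map to $\mathcal{G}(M)$.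 For a symbol $[\underline{s}]$, $[\underline{s}]^{\downarrow}$ is the symbol of the sequence obtained from $\underline{s}$ by replacing its right-most $1$ by $0$, and $[\underline{s}]^{\uparrow}$ is the symbol of the sequence obtained by replacing its left-most $0$ by $1$. The free extension $M+x$ is the matroid on $E(M)\cup\{x\}$ whose bases are the bases of $M$ together with the sets $B\cup\{x\}$ where $B$ is a basis of a copoint (flat of rank $r(M)-1$) of $M$. The free coextension is $M\times x=(M^*+x)^*$, where $^*$ is matroid duality. -}

module Defs where

open import Level using (0ℓ)
open import Algebra.Apartness.Bundles using (HeytingCommutativeRing; HeytingField)
open import Algebra.Bundles using (CommutativeRing)
import Algebra.Definitions.RawMonoid as Multiples
open import Data.Bool.Base using (Bool; true; false; T; if_then_else_)
open import Data.Empty using (⊥-elim)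
open import Data.Fin.Base using (Fin; zero; suc; toℕ; punchIn)
import Data.Fin.Properties as Fin
open import Data.Fin.Permutation as Perm using (Permutation′; _⟨$⟩ʳ_; _⟨$⟩ˡ_; remove; insert-remove; inverseʳ)
open import Data.Fin.Subset
open import Data.Fin.Subset.Properties
open import Data.List.Base as List using (List; []; _∷_; _++_; map; filter; foldr; concatMap; allFin; length; mapMaybe)
open import Data.List.Extrema.Nat using (max; xs≤max; argmax-sel)
open import Data.List.Membership.Propositional using () renaming (_∈_ to _∈ˡ_)
open import Data.List.Membership.Propositional.Properties using (∈-map⁺; ∈-map⁻; ∈-++⁺ˡ; ∈-++⁺ʳ; ∈-filter⁺; ∈-filter⁻; ∈-allFin)
import Data.List.Properties as List
open import Data.List.Relation.Unary.All as All using (All)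
open import Data.List.Relation.Unary.Any as Any using (Any; here; there)
import Data.List.Relation.Unary.Any.Properties as Any
open import Data.Maybe.Base using (Maybe; just; nothing)
open import Data.Nat.Base using (ℕ; zero; suc; _+_; _*_; _∸_; _≤_; _<_; z≤n; s≤s; s≤s⁻¹; _<ᵇ_; _!; pred)
open import Data.Nat.Induction using (<-wellFounded; Acc; acc)
open import Data.Nat.Properties using (+-identityʳ; n∸n≡0; ≤-refl; ≤-trans; ≤-reflexive; ≤-antisym; <-irrefl; <-≤-trans; n≤1+n; m≤n⇒m≤1+n; +-comm; +-suc; *-comm; +-monoʳ-≤; +-mono-≤; ∸-monoʳ-≤; m∸[m∸n]≡n; +-∸-assoc; m∸n≤m; m+n∸n≡m; suc-injective; <⇒≢; ≰⇒>; ≮⇒≥; <ᵇ⇒<; <⇒<ᵇ; _≟_; _<?_; _≤?_; m≤n⇒m<n∨m≡n; module ≤-Reasoning)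
open import Data.Product.Base using (∃; _×_; _,_; proj₁; proj₂)
open import Data.Sum.Base using (_⊎_; inj₁; inj₂)
open import Data.Vec.Base as Vec using (Vec; []; _∷_; tabulate; insertAt)
open import Data.Vec.Properties using (lookup∘tabulate; lookup⇒[]=; []=⇒lookup; ≡-dec)
import Data.Bool.Properties as Bool
open import Function.Base using (_∘_)
open import Relation.Binary.PropositionalEquality using (_≡_; _≢_; refl; sym; trans; cong; cong₂; subst)
open import Relation.Nullary.Decidable using (Dec; yes; no; ⌊_⌋; _×-dec_; _→-dec_; ¬?; recompute)
open import Relation.Nullary.Negation using (¬_; contradiction)
open import Relation.Unary using (Pred; Decidable)

private
  variable
    n r s : ℕ
    A : Set

x∈p─q⁻ : ∀ (p q : Subset n) {x} → x ∈ p ─ q → x ∈ p × x ∉ q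
x∈p─q⁻ p q x∈ = p─q⊆p p q x∈ , λ x∈q → go p q x∈ x∈q
  where
  go : ∀ {n} (p q : Subset n) {x} → x ∈ p ─ q → ¬ x ∈ q
  go (true  ∷ p) (true  ∷ q) {zero} () Vec.here
  go (false ∷ p) (true  ∷ q) {zero} () Vec.here
  go (_ ∷ p) (_ ∷ q) (Vec.there a) (Vec.there b) = go p q a b

x∈p-y⁻ : ∀ (p : Subset n) y {x} → x ∈ p - y → x ∈ p × x ≢ y
x∈p-y⁻ p y x∈ with x∈p─q⁻ p ⁅ y ⁆ x∈
... | x∈p , x∉ = x∈p , x∉⁅y⁆⇒x≢y x∉

x∈p∪⁅y⁆⁻ : ∀ (p : Subset n) y {x} → x ∈ p ∪ ⁅ y ⁆ → x ∈ p ⊎ x ≡ y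
x∈p∪⁅y⁆⁻ p y x∈ with x∈p∪q⁻ p ⁅ y ⁆ x∈
... | inj₁ x∈p = inj₁ x∈p
... | inj₂ x∈y = inj₂ (x∈⁅y⁆⇒x≡y y x∈y)

∪-least : ∀ {p q t : Subset n} → p ⊆ t → q ⊆ t → p ∪ q ⊆ t
∪-least {p = p} {q} p⊆t q⊆t x∈ with x∈p∪q⁻ p q x∈
... | inj₁ x∈p = p⊆t x∈p
... | inj₂ x∈q = q⊆t x∈q

∪⁅⁆-least : ∀ {p t : Subset n} {y} → p ⊆ t → y ∈ t → p ∪ ⁅ y ⁆ ⊆ t
∪⁅⁆-least {p = p} {y = y} p⊆t y∈t x∈ with x∈p∪⁅y⁆⁻ p y x∈
... | inj₁ x∈p  = p⊆t x∈p
... | inj₂ refl = y∈t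

y∈p∪⁅y⁆ : ∀ (p : Subset n) y → y ∈ p ∪ ⁅ y ⁆
y∈p∪⁅y⁆ p y = q⊆p∪q p ⁅ y ⁆ (x∈⁅x⁆ y)

∣p∪q∣≤∣p∣+∣q∣ : ∀ (p q : Subset n) → ∣ p ∪ q ∣ ≤ ∣ p ∣ + ∣ q ∣
∣p∪q∣≤∣p∣+∣q∣ [] [] = z≤n
∣p∪q∣≤∣p∣+∣q∣ (true ∷ p) (true ∷ q) =
  s≤s (≤-trans (∣p∪q∣≤∣p∣+∣q∣ p q) (+-monoʳ-≤ ∣ p ∣ (n≤1+n _)))
∣p∪q∣≤∣p∣+∣q∣ (true ∷ p) (false ∷ q) = s≤s (∣p∪q∣≤∣p∣+∣q∣ p q)
∣p∪q∣≤∣p∣+∣q∣ (false ∷ p) (true ∷ q) =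
  ≤-trans (s≤s (∣p∪q∣≤∣p∣+∣q∣ p q)) (≤-reflexive (sym (+-suc ∣ p ∣ ∣ q ∣)))
∣p∪q∣≤∣p∣+∣q∣ (false ∷ p) (false ∷ q) = ∣p∪q∣≤∣p∣+∣q∣ p q

∣p∪⁅x⁆∣≤1+∣p∣ : ∀ (p : Subset n) x → ∣ p ∪ ⁅ x ⁆ ∣ ≤ suc ∣ p ∣
∣p∪⁅x⁆∣≤1+∣p∣ p x = ≤-trans (∣p∪q∣≤∣p∣+∣q∣ p ⁅ x ⁆)
  (≤-reflexive (trans (cong (∣ p ∣ +_) (∣⁅x⁆∣≡1 x)) (+-comm ∣ p ∣ 1)))

x∉p⇒∣p∣<∣p∪⁅x⁆∣ : ∀ (p : Subset n) x → x ∉ p → ∣ p ∣ < ∣ p ∪ ⁅ x ⁆ ∣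
x∉p⇒∣p∣<∣p∪⁅x⁆∣ p x x∉p = p⊂q⇒∣p∣<∣q∣ (p⊆p∪q ⁅ x ⁆ , x , y∈p∪⁅y⁆ p x , x∉p)

x∉p⇒∣p∪⁅x⁆∣≡1+∣p∣ : ∀ (p : Subset n) x → x ∉ p → ∣ p ∪ ⁅ x ⁆ ∣ ≡ suc ∣ p ∣
x∉p⇒∣p∪⁅x⁆∣≡1+∣p∣ p x x∉p = ≤-antisym (∣p∪⁅x⁆∣≤1+∣p∣ p x) (x∉p⇒∣p∣<∣p∪⁅x⁆∣ p x x∉p)

∣p∣≤1+∣p-x∣ : ∀ (p : Subset n) x → ∣ p ∣ ≤ suc ∣ p - x ∣
∣p∣≤1+∣p-x∣ p x = ≤-trans (p⊆q⇒∣p∣≤∣q∣ cover) (∣p∪⁅x⁆∣≤1+∣p∣ (p - x) x)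
  where
  cover : p ⊆ (p - x) ∪ ⁅ x ⁆
  cover {y} y∈p with y Fin.≟ x
  ... | yes refl = y∈p∪⁅y⁆ (p - x) x
  ... | no  y≢x  = p⊆p∪q ⁅ x ⁆ (x∈p∧x≢y⇒x∈p-y y∈p y≢x)

∣p─q∣+∣q∣≤∣p∣ : ∀ (p q : Subset n) → q ⊆ p → ∣ p ─ q ∣ + ∣ q ∣ ≤ ∣ p ∣
∣p─q∣+∣q∣≤∣p∣ [] [] q⊆p = z≤n
∣p─q∣+∣q∣≤∣p∣ (true ∷ p) (true ∷ q) q⊆p =
  ≤-trans (≤-reflexive (+-suc _ _)) (s≤s (∣p─q∣+∣q∣≤∣p∣ p q (drop-∷-⊆ q⊆p)))
∣p─q∣+∣q∣≤∣p∣ (true ∷ p) (false ∷ q) q⊆p = s≤s (∣p─q∣+∣q∣≤∣p∣ p q (drop-∷-⊆ q⊆p))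
∣p─q∣+∣q∣≤∣p∣ (false ∷ p) (true ∷ q) q⊆p with q⊆p Vec.here
... | ()
∣p─q∣+∣q∣≤∣p∣ (false ∷ p) (false ∷ q) q⊆p = ∣p─q∣+∣q∣≤∣p∣ p q (drop-∷-⊆ q⊆p)

subsets : ∀ n → List (Subset n)
subsets zero    = [] ∷ []
subsets (suc n) = map (false ∷_) (subsets n) ++ map (true ∷_) (subsets n)

subsets-complete : ∀ (p : Subset n) → p ∈ˡ subsets n
subsets-complete [] = here refl
subsets-complete (false ∷ p) = ∈-++⁺ˡ (∈-map⁺ (false ∷_) (subsets-complete p))
subsets-complete {suc n} (true ∷ p) =
  ∈-++⁺ʳ (map (false ∷_) (subsets n)) (∈-map⁺ (true ∷_) (subsets-complete p))

-- A rank-r matroid on the ground set Fin n, given by its bases.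
record Matroid (n r : ℕ) : Set₁ where
  field
    Basis    : Pred (Subset n) 0ℓ
    basis?   : Decidable Basis
    ∃basis   : ∃ Basis
    ∣basis∣  : ∀ {B} → Basis B → ∣ B ∣ ≡ r
    exchange : ∀ {B₁ B₂ x} → Basis B₁ → Basis B₂ → x ∈ B₁ → x ∉ B₂ →
               ∃ λ y → y ∈ B₂ × y ∉ B₁ × Basis ((B₁ - x) ∪ ⁅ y ⁆)

  Independent : Pred (Subset n) 0ℓ
  Independent I = ∃ λ B → Basis B × I ⊆ B

  independent? : Decidable Independent
  independent? I = anySubset? (λ B → basis? B ×-dec I ⊆? B)

  rank : Subset n → ℕ
  rank S = max 0 (map ∣_∣ (filter (λ I → independent? I ×-dec I ⊆? S) (subsets n)))

  Flat : Pred (Subset n) 0ℓ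
  Flat F = ∀ e → e ∉ F → rank F < rank (F ∪ ⁅ e ⁆)

  -- 1 + rank F ≡ r rather than rank F ≡ r ∸ 1: a rank-0 matroid has no copoints.
  Copoint : Pred (Subset n) 0ℓ
  Copoint F = Flat F × suc (rank F) ≡ r

  -- A basis of S is a maximal independent subset of S.
  BasisOf : Subset n → Pred (Subset n) 0ℓ
  BasisOf S B = B ⊆ S × Independent B × (∀ e → e ∈ S → e ∉ B → ¬ Independent (B ∪ ⁅ e ⁆))

  copoint? : Decidable Copoint
  copoint? F =
    Fin.all? (λ e → ¬? (e ∈? F) →-dec (rank F <? rank (F ∪ ⁅ e ⁆))) ×-dec (suc (rank F) ≟ r)

  basisOf? : ∀ S → Decidable (BasisOf S)
  basisOf? S B = B ⊆? S ×-dec independent? B ×-dec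
    Fin.all? (λ e → (e ∈? S) →-dec (¬? (e ∈? B) →-dec ¬? (independent? (B ∪ ⁅ e ⁆))))

  r≤n : r ≤ n
  r≤n = subst (_≤ n) (∣basis∣ (proj₂ ∃basis)) (∣p∣≤n (proj₁ ∃basis))

  independent-⊆ : ∀ {I J} → I ⊆ J → Independent J → Independent I
  independent-⊆ I⊆J (B , bB , J⊆B) = B , bB , J⊆B ∘ I⊆J

  basis⇒independent : ∀ {B} → Basis B → Independent B
  basis⇒independent bB = _ , bB , λ x∈ → x∈

  ∣independent∣≤r : ∀ {I} → Independent I → ∣ I ∣ ≤ r
  ∣independent∣≤r (B , bB , I⊆B) = ≤-trans (p⊆q⇒∣p∣≤∣q∣ I⊆B) (≤-reflexive (∣basis∣ bB))

  extend-into : ∀ {I B₁ B₂} → Basis B₁ → Basis B₂ → I ⊆ B₂ →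
                ∃ λ B → Basis B × I ⊆ B × B ⊆ I ∪ B₁
  extend-into {I} {B₁} b₁ = go (<-wellFounded _)
    where
    go : ∀ {B₂} → Acc _<_ ∣ B₂ ─ (I ∪ B₁) ∣ → Basis B₂ → I ⊆ B₂ →
         ∃ λ B → Basis B × I ⊆ B × B ⊆ I ∪ B₁
    go {B₂} (acc rec) b₂ I⊆B₂ with nonempty? (B₂ ─ (I ∪ B₁))
    ... | no empty = B₂ , b₂ , I⊆B₂ , sub
      where
      sub : B₂ ⊆ I ∪ B₁
      sub {y} y∈ with y ∈? I ∪ B₁
      ... | yes p = p
      ... | no  p = ⊥-elim (empty (y , x∈p∧x∉q⇒x∈p─q y∈ p))
    ... | yes (z , z∈) = go (rec (p⊂q⇒∣p∣<∣q∣ (smaller , z , z∈ , z∉new))) bnew I⊆new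
      where
      z∈B₂ = proj₁ (x∈p─q⁻ B₂ (I ∪ B₁) z∈)
      z∉∪  = proj₂ (x∈p─q⁻ B₂ (I ∪ B₁) z∈)
      ex   = exchange b₂ b₁ z∈B₂ (z∉∪ ∘ q⊆p∪q I B₁)
      y    = proj₁ ex
      y∈B₁ = proj₁ (proj₂ ex)
      new  = (B₂ - z) ∪ ⁅ y ⁆
      bnew : Basis new
      bnew = proj₂ (proj₂ (proj₂ ex))
      I⊆new : I ⊆ new
      I⊆new x∈I = p⊆p∪q ⁅ y ⁆ (x∈p∧x≢y⇒x∈p-y (I⊆B₂ x∈I) λ { refl → z∉∪ (p⊆p∪q B₁ x∈I) })
      smaller : new ─ (I ∪ B₁) ⊆ B₂ ─ (I ∪ B₁)
      smaller w∈ with x∈p─q⁻ new (I ∪ B₁) w∈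
      ... | w∈new , w∉ with x∈p∪⁅y⁆⁻ (B₂ - z) y w∈new
      ...   | inj₁ w∈B₂-z = x∈p∧x∉q⇒x∈p─q (proj₁ (x∈p-y⁻ B₂ z w∈B₂-z)) w∉
      ...   | inj₂ refl   = ⊥-elim (w∉ (q⊆p∪q I B₁ y∈B₁))
      z∉new : z ∉ new ─ (I ∪ B₁)
      z∉new z∈′ with x∈p∪⁅y⁆⁻ (B₂ - z) y (proj₁ (x∈p─q⁻ new (I ∪ B₁) z∈′))
      ... | inj₁ z∈B₂-z = proj₂ (x∈p-y⁻ B₂ z z∈B₂-z) refl
      ... | inj₂ z≡y    = z∉∪ (q⊆p∪q I B₁ (subst (_∈ B₁) (sym z≡y) y∈B₁))

  augment : ∀ {I J} → Independent I → Independent J → ∣ I ∣ < ∣ J ∣ →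
            ∃ λ y → y ∈ J × y ∉ I × Independent (I ∪ ⁅ y ⁆)
  augment {I} {J} (B₂ , b₂ , I⊆B₂) (B₁ , b₁ , J⊆B₁) I<J with extend-into b₁ b₂ I⊆B₂
  ... | B , bB , I⊆B , B⊆ with nonempty? (B ∩ (J ─ I))
  ...   | yes (y , y∈) = y , proj₁ y∈J─I , proj₂ y∈J─I , B , bB , ∪⁅⁆-least I⊆B y∈B
    where
    y∈B   = proj₁ (x∈p∩q⁻ B (J ─ I) y∈)
    y∈J─I = x∈p─q⁻ J I (proj₂ (x∈p∩q⁻ B (J ─ I) y∈))
  ...   | no empty = contradiction small (<-irrefl refl)
    where
    open ≤-Reasoning
    B⊆′ : B ⊆ I ∪ (B₁ ─ J)
    B⊆′ {y} y∈B with y ∈? I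
    ... | yes y∈I = p⊆p∪q (B₁ ─ J) y∈I
    ... | no  y∉I with y ∈? J
    ...   | yes y∈J = ⊥-elim (empty (y , x∈p∩q⁺ (y∈B , x∈p∧x∉q⇒x∈p─q y∈J y∉I)))
    ...   | no  y∉J with x∈p∪q⁻ I B₁ (B⊆ y∈B)
    ...     | inj₁ y∈I  = ⊥-elim (y∉I y∈I)
    ...     | inj₂ y∈B₁ = q⊆p∪q I (B₁ ─ J) (x∈p∧x∉q⇒x∈p─q y∈B₁ y∉J)
    small : r < r
    small = begin-strict
      r                       ≡⟨ ∣basis∣ bB ⟨
      ∣ B ∣                   ≤⟨ p⊆q⇒∣p∣≤∣q∣ B⊆′ ⟩
      ∣ I ∪ (B₁ ─ J) ∣        ≤⟨ ∣p∪q∣≤∣p∣+∣q∣ I (B₁ ─ J) ⟩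
      ∣ I ∣ + ∣ B₁ ─ J ∣      <⟨ +-mono-≤ I<J ≤-refl ⟩
      ∣ J ∣ + ∣ B₁ ─ J ∣      ≡⟨ +-comm ∣ J ∣ _ ⟩
      ∣ B₁ ─ J ∣ + ∣ J ∣      ≤⟨ ∣p─q∣+∣q∣≤∣p∣ B₁ J J⊆B₁ ⟩
      ∣ B₁ ∣                  ≡⟨ ∣basis∣ b₁ ⟩
      r                       ∎

  independent-full⇒basis : ∀ {I} → Independent I → ∣ I ∣ ≡ r → Basis I
  independent-full⇒basis {I} (B , bB , I⊆B) eq = subst Basis (⊆-antisym B⊆I I⊆B) bB
    where
    B⊆I : B ⊆ I
    B⊆I {y} y∈B with y ∈? I
    ... | yes y∈I = y∈I
    ... | no  y∉I = contradiction (trans eq (sym (∣basis∣ bB)))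
                                  (<⇒≢ (p⊂q⇒∣p∣<∣q∣ (I⊆B , y , y∈B , y∉I)))

  rank-upper : ∀ {I S} → Independent I → I ⊆ S → ∣ I ∣ ≤ rank S
  rank-upper {I} {S} iI I⊆S = All.lookup (xs≤max 0 _)
    (∈-map⁺ ∣_∣ (∈-filter⁺ (λ I → independent? I ×-dec I ⊆? S) (subsets-complete I) (iI , I⊆S)))

  rank-attained : ∀ S → ∃ λ I → Independent I × I ⊆ S × ∣ I ∣ ≡ rank S
  rank-attained S
    with argmax-sel (λ k → k) 0 (map ∣_∣ (filter (λ I → independent? I ×-dec I ⊆? S) (subsets n)))
  ... | inj₁ eq = ⊥ , (proj₁ ∃basis , proj₂ ∃basis , ⊥⊆) , ⊥⊆ , trans (∣⊥∣≡0 n) (sym eq)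
  ... | inj₂ mem with ∈-map⁻ ∣_∣ mem
  ...   | I , I∈ , eq with ∈-filter⁻ (λ I → independent? I ×-dec I ⊆? S) {xs = subsets n} I∈
  ...     | _ , iI , I⊆S = I , iI , I⊆S , sym eq

  rank-mono : ∀ {S S′} → S ⊆ S′ → rank S ≤ rank S′
  rank-mono {S} S⊆S′ with rank-attained S
  ... | I , iI , I⊆S , eq = subst (_≤ _) eq (rank-upper iI (S⊆S′ ∘ I⊆S))

  rank-step : ∀ {S S′} e → S′ ⊆ S ∪ ⁅ e ⁆ → rank S′ ≤ suc (rank S)
  rank-step {S} {S′} e S′⊆ with rank-attained S′
  ... | I , iI , I⊆S′ , eq = ≤-trans (≤-reflexive (sym eq))
    (≤-trans (∣p∣≤1+∣p-x∣ I e) (s≤s (rank-upper (independent-⊆ (p─q⊆p I ⁅ e ⁆) iI) I-e⊆S)))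
    where
    I-e⊆S : I - e ⊆ S
    I-e⊆S x∈ with x∈p-y⁻ I e x∈
    ... | x∈I , x≢e with x∈p∪⁅y⁆⁻ S e (S′⊆ (I⊆S′ x∈I))
    ...   | inj₁ x∈S = x∈S
    ...   | inj₂ x≡e = ⊥-elim (x≢e x≡e)

  rank≤r : ∀ S → rank S ≤ r
  rank≤r S with rank-attained S
  ... | I , iI , _ , eq = subst (_≤ r) eq (∣independent∣≤r iI)

  rank-⊥ : rank ⊥ ≡ 0
  rank-⊥ with rank-attained ⊥
  ... | I , _ , I⊆⊥ , eq = trans (sym eq)
    (≤-antisym (≤-trans (p⊆q⇒∣p∣≤∣q∣ I⊆⊥) (≤-reflexive (∣⊥∣≡0 n))) z≤n)

  rank-⊤ : rank ⊤ ≡ r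
  rank-⊤ = ≤-antisym (rank≤r ⊤)
    (subst (_≤ rank ⊤) (∣basis∣ (proj₂ ∃basis)) (rank-upper (basis⇒independent (proj₂ ∃basis)) ⊆⊤))

  -- B is a basis of a copoint iff B is independent of size r - 1.
  basisOfCopoint⁻ : ∀ {F B} → Copoint F → BasisOf F B → Independent B × suc ∣ B ∣ ≡ r
  basisOfCopoint⁻ {F} {B} (_ , rk) (B⊆F , iB , maximal) = iB , trans (cong suc size) rk
    where
    size : ∣ B ∣ ≡ rank F
    size with m≤n⇒m<n∨m≡n (rank-upper iB B⊆F)
    ... | inj₂ eq = eq
    ... | inj₁ lt with rank-attained F
    ...   | J , iJ , J⊆F , eq with augment iB iJ (subst (∣ B ∣ <_) (sym eq) lt)
    ...     | y , y∈J , y∉B , iBy = ⊥-elim (maximal y (J⊆F y∈J) y∉B iBy)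

  basisOfCopoint⁺ : ∀ {B} → Independent B → suc ∣ B ∣ ≡ r → ∃ λ F → Copoint F × BasisOf F B
  basisOfCopoint⁺ {B} iB eq = F , (flat , trans (cong suc rankF) eq) , B⊆F , iB , maximal
    where
    F : Subset n
    F = tabulate (λ e → ⌊ rank (B ∪ ⁅ e ⁆) ≤? ∣ B ∣ ⌋)

    ∈F⁻ : ∀ {e} → e ∈ F → rank (B ∪ ⁅ e ⁆) ≤ ∣ B ∣
    ∈F⁻ {e} e∈ with trans (sym (lookup∘tabulate (λ e → ⌊ rank (B ∪ ⁅ e ⁆) ≤? ∣ B ∣ ⌋) e)) ([]=⇒lookup e∈)
    ... | p with rank (B ∪ ⁅ e ⁆) ≤? ∣ B ∣
    ...   | yes q = q

    ∈F⁺ : ∀ {e} → rank (B ∪ ⁅ e ⁆) ≤ ∣ B ∣ → e ∈ F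
    ∈F⁺ {e} le = lookup⇒[]= e F (trans (lookup∘tabulate (λ e → ⌊ rank (B ∪ ⁅ e ⁆) ≤? ∣ B ∣ ⌋) e) helper)
      where
      helper : ⌊ rank (B ∪ ⁅ e ⁆) ≤? ∣ B ∣ ⌋ ≡ true
      helper with rank (B ∪ ⁅ e ⁆) ≤? ∣ B ∣
      ... | yes _ = refl
      ... | no ¬q = ⊥-elim (¬q le)

    maximal : ∀ e → e ∈ F → e ∉ B → ¬ Independent (B ∪ ⁅ e ⁆)
    maximal e e∈F e∉B iBe = <-irrefl refl (<-≤-trans (x∉p⇒∣p∣<∣p∪⁅x⁆∣ B e e∉B)
      (≤-trans (rank-upper iBe (λ x∈ → x∈)) (∈F⁻ e∈F)))

    B⊆F : B ⊆ F
    B⊆F {e} e∈B with rank-attained (B ∪ ⁅ e ⁆)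
    ... | I , iI , I⊆ , eq′ = ∈F⁺ (subst (_≤ ∣ B ∣) eq′
      (p⊆q⇒∣p∣≤∣q∣ (∪⁅⁆-least (λ x∈ → x∈) e∈B ∘ I⊆)))

    rankF : rank F ≡ ∣ B ∣
    rankF with rank-attained F
    ... | J , iJ , J⊆F , eq′ with ∣ B ∣ <? rank F
    ...   | no ¬lt = ≤-antisym (≮⇒≥ ¬lt) (rank-upper iB B⊆F)
    ...   | yes lt with augment iB iJ (subst (∣ B ∣ <_) (sym eq′) lt)
    ...     | y , y∈J , y∉B , iBy = ⊥-elim (maximal y (J⊆F y∈J) y∉B iBy)

    flat : Flat F
    flat e e∉F = subst (_< rank (F ∪ ⁅ e ⁆)) (sym rankF)
      (<-≤-trans (≰⇒> (λ le → e∉F (∈F⁺ le)))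
        (rank-mono (∪-least (p⊆p∪q ⁅ e ⁆ ∘ B⊆F) (q⊆p∪q F ⁅ e ⁆))))

castRank : r ≡ s → Matroid n r → Matroid n s
castRank eq M = record
  { Basis    = Basis
  ; basis?   = basis?
  ; ∃basis   = ∃basis
  ; ∣basis∣  = λ bB → trans (∣basis∣ bB) eq
  ; exchange = exchange
  }
  where open Matroid M

∁-involutive : ∀ (p : Subset n) → ∁ (∁ p) ≡ p
∁-involutive [] = refl
∁-involutive (x ∷ p) = cong₂ _∷_ (Bool.not-involutive x) (∁-involutive p)

infix 9 _*ᴹ

_*ᴹ : Matroid n r → Matroid n (n ∸ r)
_*ᴹ {n} {r} M = record
  { Basis    = Basis ∘ ∁
  ; basis?   = basis? ∘ ∁
  ; ∃basis   = ∁ B₀ , subst Basis (sym (∁-involutive B₀)) (proj₂ ∃basis)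
  ; ∣basis∣  = λ {B} bB → trans (cong ∣_∣ (sym (∁-involutive B)))
                         (trans (∣∁p∣≡n∸∣p∣ (∁ B)) (cong (n ∸_) (∣basis∣ bB)))
  ; exchange = dual-exchange
  }
  where
  open Matroid M
  B₀ = proj₁ ∃basis

  dual-exchange : ∀ {B₁ B₂ x} → Basis (∁ B₁) → Basis (∁ B₂) → x ∈ B₁ → x ∉ B₂ →
                  ∃ λ y → y ∈ B₂ × y ∉ B₁ × Basis (∁ ((B₁ - x) ∪ ⁅ y ⁆))
  dual-exchange {B₁} {B₂} {x} b₁ b₂ x∈B₁ x∉B₂
    with extend-into {I = (∁ B₁ ∩ ∁ B₂) ∪ ⁅ x ⁆} b₁ b₂
           (∪⁅⁆-least (p∩q⊆q (∁ B₁) (∁ B₂)) (x∉p⇒x∈∁p x∉B₂))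
  ... | B , bB , I⊆B , B⊆ with nonempty? (∁ B₁ ─ B)
  ...   | no empty = contradiction (trans (∣basis∣ b₁) (sym (∣basis∣ bB)))
                       (<⇒≢ (p⊂q⇒∣p∣<∣q∣ (sub , x , I⊆B (y∈p∪⁅y⁆ _ x) , x∈p⇒x∉∁p x∈B₁)))
    where
    sub : ∁ B₁ ⊆ B
    sub {w} w∈ with w ∈? B
    ... | yes p = p
    ... | no  p = ⊥-elim (empty (w , x∈p∧x∉q⇒x∈p─q w∈ p))
  ...   | yes (y , y∈) = y , y∈B₂ , y∉B₁ , independent-full⇒basis (B , bB , ⊆B) size
    where
    y∈∁B₁ = proj₁ (x∈p─q⁻ (∁ B₁) B y∈)
    y∉B   = proj₂ (x∈p─q⁻ (∁ B₁) B y∈)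
    y∉B₁  = x∈∁p⇒x∉p y∈∁B₁
    y∈B₂ : y ∈ B₂
    y∈B₂ with y ∈? B₂
    ... | yes p = p
    ... | no  p = ⊥-elim (y∉B (I⊆B (p⊆p∪q ⁅ x ⁆ (x∈p∩q⁺ (y∈∁B₁ , x∉p⇒x∈∁p p)))))
    new = (B₁ - x) ∪ ⁅ y ⁆
    x∉new : x ∉ new
    x∉new x∈ with x∈p∪⁅y⁆⁻ (B₁ - x) y x∈
    ... | inj₁ x∈- = proj₂ (x∈p-y⁻ B₁ x x∈-) refl
    ... | inj₂ refl = x∉B₂ y∈B₂
    B⊆∁new : B ⊆ ∁ new
    B⊆∁new {w} w∈B = x∉p⇒x∈∁p w∉
      where
      w∉ : w ∉ new
      w∉ w∈ with x∈p∪⁅y⁆⁻ (B₁ - x) y w∈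
      ... | inj₂ refl = y∉B w∈B
      ... | inj₁ w∈- with x∈p∪q⁻ _ (∁ B₁) (B⊆ w∈B)
      ...   | inj₂ w∈∁B₁ = x∈∁p⇒x∉p w∈∁B₁ (proj₁ (x∈p-y⁻ B₁ x w∈-))
      ...   | inj₁ w∈I with x∈p∪⁅y⁆⁻ (∁ B₁ ∩ ∁ B₂) x w∈I
      ...     | inj₁ w∈∩  = x∈∁p⇒x∉p (p∩q⊆p (∁ B₁) (∁ B₂) w∈∩) (proj₁ (x∈p-y⁻ B₁ x w∈-))
      ...     | inj₂ refl = proj₂ (x∈p-y⁻ B₁ x w∈-) refl
    y∉B₁-x : y ∉ B₁ - x
    y∉B₁-x y∈- = y∉B₁ (proj₁ (x∈p-y⁻ B₁ x y∈-))
    open ≤-Reasoning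
    ∣∁new∣≤r : ∣ ∁ new ∣ ≤ r
    ∣∁new∣≤r = begin
      ∣ ∁ new ∣             ≡⟨ ∣∁p∣≡n∸∣p∣ new ⟩
      n ∸ ∣ new ∣           ≡⟨ cong (n ∸_) (x∉p⇒∣p∪⁅x⁆∣≡1+∣p∣ (B₁ - x) y y∉B₁-x) ⟩
      n ∸ suc ∣ B₁ - x ∣    ≤⟨ ∸-monoʳ-≤ n (∣p∣≤1+∣p-x∣ B₁ x) ⟩
      n ∸ ∣ B₁ ∣            ≡⟨ ∣∁p∣≡n∸∣p∣ B₁ ⟨
      ∣ ∁ B₁ ∣              ≡⟨ ∣basis∣ b₁ ⟩
      r                     ∎
    B≡∁new : B ≡ ∁ new
    B≡∁new = ⊆-antisym B⊆∁new back
      where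
      back : ∁ new ⊆ B
      back {w} w∈ with w ∈? B
      ... | yes p = p
      ... | no  p = contradiction
        (<-≤-trans (p⊂q⇒∣p∣<∣q∣ (B⊆∁new , w , w∈ , p)) ∣∁new∣≤r)
        (λ lt → <-irrefl (∣basis∣ bB) lt)
    ⊆B : ∁ new ⊆ B
    ⊆B {w} = subst (w ∈_) (sym B≡∁new)
    size : ∣ ∁ new ∣ ≡ r
    size = trans (cong ∣_∣ (sym B≡∁new)) (∣basis∣ bB)

-- The new element x is zero : Fin (suc n); e : Fin n becomes suc e.  So
-- outside ∷ B is the set B, and inside ∷ B is B ∪ {x}.
FreeExtensionBasis : Matroid n r → Pred (Subset (suc n)) 0ℓ
FreeExtensionBasis M (outside ∷ B) = Matroid.Basis M B
FreeExtensionBasis M (inside  ∷ B) = ∃ λ F → Copoint F × BasisOf F B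
  where open Matroid M

infix 9 _+x _×x

_+x : Matroid n r → Matroid (suc n) r
_+x {n} {r} M = record
  { Basis    = FreeExtensionBasis M
  ; basis?   = dec
  ; ∃basis   = outside ∷ proj₁ ∃basis , proj₂ ∃basis
  ; ∣basis∣  = λ {B} → size B
  ; exchange = λ {B₁} {B₂} → exch B₁ B₂
  }
  where
  open Matroid M

  FB : Pred (Subset (suc n)) 0ℓ
  FB = FreeExtensionBasis M

  dec : Decidable FB
  dec (outside ∷ B) = basis? B
  dec (inside  ∷ B) = anySubset? (λ F → copoint? F ×-dec basisOf? F B)

  size : ∀ B → FB B → ∣ B ∣ ≡ r
  size (outside ∷ B) bB = ∣basis∣ bB
  size (inside  ∷ B) (F , cF , bB) = proj₂ (basisOfCopoint⁻ cF bB)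

  ∪⊥ : ∀ {m} (p : Subset m) → p ∪ ⊥ ≡ p
  ∪⊥ p = ⊆-antisym (∪-least (λ x∈ → x∈) ⊥⊆) (p⊆p∪q ⊥)

  ∣p-x∣≡ : ∀ (p : Subset n) x → x ∈ p → ∣ p ∣ ≡ suc ∣ p - x ∣
  ∣p-x∣≡ p x x∈p = ≤-antisym (∣p∣≤1+∣p-x∣ p x) (x∈p⇒∣p-x∣<∣p∣ x∈p)

  near : ∀ {B₁ B₂ e k} → Independent B₁ → Independent B₂ → e ∈ B₁ → e ∉ B₂ →
         ∣ B₁ ∣ ≡ k → k ≤ ∣ B₂ ∣ →
         ∃ λ y → y ∈ B₂ × y ∉ B₁ × Independent ((B₁ - e) ∪ ⁅ y ⁆) × ∣ (B₁ - e) ∪ ⁅ y ⁆ ∣ ≡ k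
  near {B₁} {B₂} {e} {k} i₁ i₂ e∈ e∉ eq le
    with augment (independent-⊆ (p─q⊆p B₁ ⁅ e ⁆) i₁) i₂
           (<-≤-trans (x∈p⇒∣p-x∣<∣p∣ e∈) (≤-trans (≤-reflexive eq) le))
  ... | y , y∈ , y∉ , i = y , y∈ , y∉B₁ , i
      , trans (x∉p⇒∣p∪⁅x⁆∣≡1+∣p∣ (B₁ - e) y y∉) (trans (sym (∣p-x∣≡ B₁ e e∈)) eq)
    where
    y∉B₁ : y ∉ B₁
    y∉B₁ y∈B₁ = y∉ (x∈p∧x≢y⇒x∈p-y y∈B₁ λ { refl → e∉ y∈ })

  sizes : ∀ {F B} → Copoint F → BasisOf F B → ∣ B ∣ ≡ pred r
  sizes cF bB = cong pred (proj₂ (basisOfCopoint⁻ cF bB))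

  exch : ∀ B₁ B₂ {e} → FB B₁ → FB B₂ → e ∈ B₁ → e ∉ B₂ →
         ∃ λ y → y ∈ B₂ × y ∉ B₁ × FB ((B₁ - e) ∪ ⁅ y ⁆)
  exch (outside ∷ B₁) (outside ∷ B₂) {suc e} b₁ b₂ (Vec.there e∈) e∉
    with exchange b₁ b₂ e∈ (drop-not-there e∉)
  ... | y , y∈ , y∉ , b = suc y , Vec.there y∈ , (λ { (Vec.there p) → y∉ p }) , b
  exch (outside ∷ B₁) (inside ∷ B₂) {suc e} b₁ b₂ (Vec.there e∈) e∉ =
    zero , Vec.here , (λ ()) ,
    subst (λ B → FB (inside ∷ B)) (sym (∪⊥ (B₁ - e)))
      (basisOfCopoint⁺ (independent-⊆ (p─q⊆p B₁ ⁅ e ⁆) (basis⇒independent b₁))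
        (trans (sym (∣p-x∣≡ B₁ e e∈)) (∣basis∣ b₁)))
  exch (inside ∷ B₁) (outside ∷ B₂) {zero} (F , cF , b₁) b₂ Vec.here e∉
    with basisOfCopoint⁻ cF b₁
  ... | i₁ , eq
    with augment i₁ (basis⇒independent b₂) (≤-reflexive (trans eq (sym (∣basis∣ b₂))))
  ... | y , y∈ , y∉ , i = suc y , Vec.there y∈ , (λ { (Vec.there p) → y∉ p }) ,
    subst (λ B → Basis (B ∪ ⁅ y ⁆)) (sym (p─⊥≡p B₁))
      (independent-full⇒basis i (trans (x∉p⇒∣p∪⁅x⁆∣≡1+∣p∣ B₁ y y∉) eq))
  exch (inside ∷ B₁) (outside ∷ B₂) {suc e} (F , cF , b₁) b₂ (Vec.there e∈) e∉
    with basisOfCopoint⁻ cF b₁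
  ... | i₁ , eq
    with near i₁ (basis⇒independent b₂) e∈ (drop-not-there e∉) refl
           (≤-trans (n≤1+n _) (≤-reflexive (trans eq (sym (∣basis∣ b₂)))))
  ... | y , y∈ , y∉ , i , sz = suc y , Vec.there y∈ , (λ { (Vec.there p) → y∉ p }) ,
    basisOfCopoint⁺ i (trans (cong suc sz) eq)
  exch (inside ∷ B₁) (inside ∷ B₂) {zero} b₁ b₂ e∈ e∉ = ⊥-elim (e∉ Vec.here)
  exch (inside ∷ B₁) (inside ∷ B₂) {suc e} (F , cF , b₁) (F′ , cF′ , b₂) (Vec.there e∈) e∉
    with basisOfCopoint⁻ cF b₁ | basisOfCopoint⁻ cF′ b₂
  ... | i₁ , eq | i₂ , eq₂
    with near i₁ i₂ e∈ (drop-not-there e∉) refl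
           (≤-reflexive (suc-injective (trans eq (sym eq₂))))
  ... | y , y∈ , y∉ , i , sz = suc y , Vec.there y∈ , (λ { (Vec.there p) → y∉ p }) ,
    basisOfCopoint⁺ i (trans (cong suc sz) eq)

coextensionRank : Matroid n r → suc n ∸ (n ∸ r) ≡ suc r
coextensionRank {n} {r} M = trans (+-∸-assoc 1 (m∸n≤m n r)) (cong suc (m∸[m∸n]≡n (Matroid.r≤n M)))

_×x : Matroid n r → Matroid (suc n) (suc r)
M ×x = castRank (coextensionRank M) ((M *ᴹ +x) *ᴹ)

-- A permutation is read as a linear ordering: π ⟨$⟩ʳ i is the element in
-- position i.  insert i zero π puts the element zero in position i and arranges the
-- remaining elements as in π.
permutations : ∀ n → List (Permutation′ n)
permutations zero    = Perm.id ∷ []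
permutations (suc n) =
  concatMap (λ π → map (λ i → Perm.insert i zero π) (allFin (suc n))) (permutations n)

insert-cong : ∀ i j {π ρ : Permutation′ n} → π Perm.≈ ρ → Perm.insert i j π Perm.≈ Perm.insert i j ρ
insert-cong i j π≈ρ k with i Fin.≟ k
... | yes _ = refl
... | no  _ = cong (punchIn j) (π≈ρ _)

-- Together with the count n !, completeness says that every permutation is
-- listed exactly once.
permutations-complete : ∀ (π : Permutation′ n) → Any (π Perm.≈_) (permutations n)
permutations-complete {zero}  π = here (λ ())
permutations-complete {suc n} π =
  Any.concatMap⁺ (λ ρ → map (λ i → Perm.insert i zero ρ) (allFin (suc n)))
    (Any.map (λ {ρ} eq → Any.map⁺ (Any.map (λ { refl → lemma ρ eq }) (∈-allFin i)))
             (permutations-complete (remove i π)))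
  where
  i = π ⟨$⟩ˡ zero
  lemma : ∀ ρ → remove i π Perm.≈ ρ → π Perm.≈ Perm.insert i zero ρ
  lemma ρ eq k = trans (sym (insert-remove i π k))
    (trans (cong (λ j → Perm.insert i j (remove i π) ⟨$⟩ʳ k) (inverseʳ π))
           (insert-cong i zero {remove i π} {ρ} eq k))

length-permutations : ∀ n → length (permutations n) ≡ n !
length-permutations zero    = refl
length-permutations (suc n) = trans (go (permutations n)) (trans (cong (_* suc n) (length-permutations n)) (*-comm (n !) (suc n)))
  where
  f : Permutation′ n → List (Permutation′ (suc n))
  f π = map (λ i → Perm.insert i zero π) (allFin (suc n))
  go : ∀ πs → length (concatMap f πs) ≡ length πs * suc n
  go [] = refl
  go (π ∷ πs) = trans (List.length-++ (f π))
    (cong₂ _+_ (trans (List.length-map (λ i → Perm.insert i zero π) (allFin (suc n))) (List.length-tabulate {n = suc n} (λ i → i)))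
               (go πs))

-- The set {π(1), …, π(k)} of elements in the first k positions.
prefix : Permutation′ n → ℕ → Subset n
prefix π k = tabulate (λ e → toℕ (π ⟨$⟩ˡ e) <ᵇ k)

T⇒≡true : ∀ {b} → T b → b ≡ true
T⇒≡true {true} _ = refl

≡true⇒T : ∀ {b} → b ≡ true → T b
≡true⇒T refl = _

∈-prefix⁺ : ∀ (π : Permutation′ n) k {e} → toℕ (π ⟨$⟩ˡ e) < k → e ∈ prefix π k
∈-prefix⁺ π k {e} lt =
  lookup⇒[]= e _ (trans (lookup∘tabulate (λ e → toℕ (π ⟨$⟩ˡ e) <ᵇ k) e) (T⇒≡true (<⇒<ᵇ lt)))

∈-prefix⁻ : ∀ (π : Permutation′ n) k {e} → e ∈ prefix π k → toℕ (π ⟨$⟩ˡ e) < k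
∈-prefix⁻ π k {e} e∈ = <ᵇ⇒< _ _ (≡true⇒T
  (trans (sym (lookup∘tabulate (λ e → toℕ (π ⟨$⟩ˡ e) <ᵇ k) e)) ([]=⇒lookup e∈)))

prefix-zero : ∀ (π : Permutation′ n) → prefix π 0 ≡ ⊥
prefix-zero π = ⊆-antisym (λ e∈ → contradiction (∈-prefix⁻ π 0 e∈) λ ()) ⊥⊆

prefix-full : ∀ (π : Permutation′ n) → prefix π n ≡ ⊤
prefix-full {n} π = ⊆-antisym ⊆⊤ (λ {e} _ → ∈-prefix⁺ π n (Fin.toℕ<n (π ⟨$⟩ˡ e)))

prefix-suc⊇ : ∀ (π : Permutation′ n) k → prefix π k ⊆ prefix π (suc k)
prefix-suc⊇ π k e∈ = ∈-prefix⁺ π (suc k) (m≤n⇒m≤1+n (∈-prefix⁻ π k e∈))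

prefix-suc⊆ : ∀ (π : Permutation′ n) i → prefix π (suc (toℕ i)) ⊆ prefix π (toℕ i) ∪ ⁅ π ⟨$⟩ʳ i ⁆
prefix-suc⊆ π i {e} e∈ with m≤n⇒m<n∨m≡n (s≤s⁻¹ (∈-prefix⁻ π (suc (toℕ i)) e∈))
... | inj₁ lt = p⊆p∪q ⁅ π ⟨$⟩ʳ i ⁆ (∈-prefix⁺ π (toℕ i) lt)
... | inj₂ eq = subst (_∈ prefix π (toℕ i) ∪ ⁅ π ⟨$⟩ʳ i ⁆)
  (trans (cong (π ⟨$⟩ʳ_) (sym (Fin.toℕ-injective eq))) (inverseʳ π))
  (y∈p∪⁅y⁆ (prefix π (toℕ i)) (π ⟨$⟩ʳ i))

-- true is 1 and false is 0, so ∣_∣ counts the ones.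
record Seq (n r : ℕ) : Set where
  constructor mkSeq
  field
    bits  : Vec Bool n
    .ones : ∣ bits ∣ ≡ r

open Seq public

toSeq : ∀ r → Vec Bool n → Maybe (Seq n r)
toSeq r v with ∣ v ∣ ≟ r
... | yes eq = just (mkSeq v eq)
... | no  _  = nothing

seqs : ∀ n r → List (Seq n r)
seqs n r = mapMaybe (toSeq r) (subsets n)

_≟ˢ_ : (s t : Seq n r) → Dec (s ≡ t)
mkSeq v p ≟ˢ mkSeq w q with ≡-dec Bool._≟_ v w
... | yes refl = yes refl
... | no  v≢w  = no (v≢w ∘ cong bits)

r<1+n : Seq n r → r < suc n
r<1+n {n} {r} (mkSeq v p) = recompute (r <? suc n) (s≤s (subst (_≤ n) p (∣p∣≤n v)))

insertAt-1-count : ∀ (v : Vec Bool n) j → ∣ insertAt v j true ∣ ≡ suc ∣ v ∣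
insertAt-1-count v zero = refl
insertAt-1-count (true  ∷ v) (suc j) = cong suc (insertAt-1-count v j)
insertAt-1-count (false ∷ v) (suc j) = insertAt-1-count v j

insertAt-0-count : ∀ (v : Vec Bool n) j → ∣ insertAt v j false ∣ ≡ ∣ v ∣
insertAt-0-count v zero = refl
insertAt-0-count (true  ∷ v) (suc j) = cong suc (insertAt-0-count v j)
insertAt-0-count (false ∷ v) (suc j) = insertAt-0-count v j

-- r₁…rₙ ↦ r₁…rⱼ 1 rⱼ₊₁…rₙ, for 0 ≤ j ≤ n
insert1 : Fin (suc n) → Seq n r → Seq (suc n) (suc r)
insert1 j (mkSeq v p) = mkSeq (insertAt v j true) (trans (insertAt-1-count v j) (cong suc p))

-- r₁…rₙ ↦ r₁…rⱼ 0 rⱼ₊₁…rₙ, for 0 ≤ j ≤ n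
insert0 : Fin (suc n) → Seq n r → Seq (suc n) r
insert0 j (mkSeq v p) = mkSeq (insertAt v j false) (trans (insertAt-0-count v j) p)

-- Replaces the right-most 1 by 0, if there is a 1.
lastOneToZero : Vec Bool n → Vec Bool n
lastOneToZero [] = []
lastOneToZero (b ∷ v) = if 0 <ᵇ ∣ v ∣ then b ∷ lastOneToZero v else false ∷ v

-- Replaces the left-most 0 by 1, if there is a 0.
firstZeroToOne : Vec Bool n → Vec Bool n
firstZeroToOne [] = []
firstZeroToOne (true  ∷ v) = true ∷ firstZeroToOne v
firstZeroToOne (false ∷ v) = true ∷ v

lastOneToZero-count : ∀ (v : Vec Bool n) → ∣ lastOneToZero v ∣ ≡ pred ∣ v ∣
lastOneToZero-count [] = refl
lastOneToZero-count (b ∷ v) with ∣ v ∣ in eq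
lastOneToZero-count (true  ∷ v) | zero  = eq
lastOneToZero-count (false ∷ v) | zero  = eq
lastOneToZero-count (true  ∷ v) | suc k =
  cong suc (trans (lastOneToZero-count v) (cong pred eq))
lastOneToZero-count (false ∷ v) | suc k = trans (lastOneToZero-count v) (cong pred eq)

firstZeroToOne-count : ∀ (v : Vec Bool n) → ∣ v ∣ < n → ∣ firstZeroToOne v ∣ ≡ suc ∣ v ∣
firstZeroToOne-count (true  ∷ v) (s≤s lt) = cong suc (firstZeroToOne-count v lt)
firstZeroToOne-count (false ∷ v) _ = refl

infixl 8 _↓ _↑⟨_⟩

-- Typed so that ↓ applies only to sequences containing a 1, and ↑ only to
-- sequences containing a 0.
_↓ : Seq n (suc r) → Seq n r
mkSeq v p ↓ = mkSeq (lastOneToZero v) (trans (lastOneToZero-count v) (cong pred p))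

_↑⟨_⟩ : Seq n r → .(r < n) → Seq n (suc r)
_↑⟨_⟩ {n} (mkSeq v p) r<n =
  mkSeq (firstZeroToOne v) (trans (firstZeroToOne-count v (subst (_< n) (sym p) r<n)) (cong suc p))

-- The rank increments are 0 or 1.
bit : ℕ → Bool
bit zero    = false
bit (suc _) = true

increments-count : ∀ n (f : ℕ → ℕ) →
  (∀ (i : Fin n) → f (toℕ i) ≤ f (suc (toℕ i))) →
  (∀ (i : Fin n) → f (suc (toℕ i)) ≤ suc (f (toℕ i))) →
  ∣ tabulate {n = n} (λ i → bit (f (suc (toℕ i)) ∸ f (toℕ i))) ∣ + f 0 ≡ f n
increments-count zero f lo hi = refl
increments-count (suc n) f lo hi
  with m≤n⇒m<n∨m≡n (lo zero) | increments-count n (f ∘ suc) (lo ∘ suc) (hi ∘ suc)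
... | inj₂ eq | ih rewrite sym eq | n∸n≡0 (f 0) = ih
... | inj₁ lt | ih rewrite ≤-antisym (hi zero) lt | m+n∸n≡m 1 (f 0) = trans (sym (+-suc _ (f 0))) ih

module _ (M : Matroid n r) where
  open Matroid M

  -- r₁ = r({π(1)}) is covered by the general formula, as r(∅) = 0.
  rankBits : Permutation′ n → Vec Bool n
  rankBits π = tabulate (λ i → bit (rank (prefix π (suc (toℕ i))) ∸ rank (prefix π (toℕ i))))

  rankBits-count : ∀ π → ∣ rankBits π ∣ ≡ r
  rankBits-count π = trans (sym (+-identityʳ _))
    (trans (cong (∣ rankBits π ∣ +_) (sym (trans (cong rank (prefix-zero π)) rank-⊥)))
    (trans (increments-count n (rank ∘ prefix π)
             (λ i → rank-mono (prefix-suc⊇ π (toℕ i)))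
             (λ i → rank-step (π ⟨$⟩ʳ i) (prefix-suc⊆ π i)))
           (trans (cong rank (prefix-full π)) rank-⊤)))

  rankSeq : Permutation′ n → Seq n r
  rankSeq π = mkSeq (rankBits π) (rankBits-count π)

CharacteristicZero : ∀ {c ℓ₁ ℓ₂} → HeytingField c ℓ₁ ℓ₂ → Set ℓ₁
CharacteristicZero K = ∀ m → ¬ (suc m ×ℕ 1# ≈ 0#)
  where
  open HeytingField K using (heytingCommutativeRing)
  open CommutativeRing (HeytingCommutativeRing.commutativeRing heytingCommutativeRing)
    using (_≈_; 0#; 1#; +-rawMonoid)
  open Multiples +-rawMonoid renaming (_×_ to infixr 8 _×ℕ_)

module GInvariant {c ℓ₁ ℓ₂} (K : HeytingField c ℓ₁ ℓ₂) where
  open HeytingField K using (Carrier; _≈_; 0#; 1#) renaming (_+_ to _+ᴷ_; _*_ to _*ᴷ_)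

  -- Vectors are given by their coordinates in the basis of symbols.
  𝒢-space : ℕ → ℕ → Set c
  𝒢-space n r = Seq n r → Carrier

  infix  4 _≋_
  infixl 6 _⊕_
  infixr 7 _·_

  _≋_ : 𝒢-space n r → 𝒢-space n r → Set ℓ₁
  u ≋ v = ∀ s → u s ≈ v s

  _⊕_ : 𝒢-space n r → 𝒢-space n r → 𝒢-space n r
  (u ⊕ v) s = u s +ᴷ v s

  _·_ : Carrier → 𝒢-space n r → 𝒢-space n r
  (a · v) s = a *ᴷ v s

  𝟎 : 𝒢-space n r
  𝟎 s = 0#

  ∑ : List A → (A → 𝒢-space n r) → 𝒢-space n r
  ∑ xs f = foldr (λ x v → f x ⊕ v) 𝟎 xs

  [_] : Seq n r → 𝒢-space n r
  [ s ] t = if ⌊ s ≟ˢ t ⌋ then 1# else 0#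

  𝒢 : Matroid n r → 𝒢-space n r
  𝒢 {n} M = ∑ (permutations n) (λ π → [ rankSeq M π ])

  -- The linear extension of an assignment of values to the symbols.
  specialize : ∀ {m s} → (Seq n r → 𝒢-space m s) → 𝒢-space n r → 𝒢-space m s
  specialize {n} {r} f v = ∑ (seqs n r) (λ t → v t · f t)

{-# OPTIONS --safe #-}
module Submission where

-- For S ⊆ E,
--   r(M + x) S = r S,                   r(M + x) (S ∪ x) = min (r M) (r S + 1),
--   r(M × x) S = min ∣S∣ (r S + 1),     r(M × x) (S ∪ x) = r S + 1.
-- On 0,1-sequences, with ranks of initial segments read as numbers of ones in
-- initial segments, capping these numbers by one less than their final value
-- deletes the right-most 1, and replacing them by min k (· + 1),
-- k the length of the segment, turns the
-- left-most 0 into 1.  So when x is inserted in position i of an ordering π of E,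
-- the rank sequence of the new ordering is that of π with a 1 (a 0) inserted in
-- position i and then ↓ (↑) applied; sum over i and π.

open import Defs
open import Algebra.Apartness.Bundles using (HeytingCommutativeRing; HeytingField)
open import Algebra.Bundles using (CommutativeMonoid; CommutativeRing)
import Algebra.Construct.Pointwise as Pointwise
import Algebra.Properties.CommutativeSemigroup as CommutativeSemigroupProperties
open import Data.Bool.Base using (Bool; true; false; if_then_else_)
open import Data.Bool.Properties using () renaming (_≟_ to _≟ᵇ_)
open import Data.Fin.Base using (Fin; zero; suc; toℕ; fromℕ<; punchIn)
open import Data.Fin.Permutation as Perm using (Permutation′; _⟨$⟩ʳ_; _⟨$⟩ˡ_; inverseˡ)
import Data.Fin.Properties as Fin
open import Data.Fin.Subset
open import Data.Fin.Subset.Properties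
open import Data.List.Base as List using (List; []; _∷_; _++_; map; concatMap; mapMaybe; allFin)
import Data.List.Properties as List
open import Data.Maybe.Base using (Maybe; just; nothing; maybe′)
open import Data.Nat.Base using (ℕ; zero; suc; pred; _+_; _∸_; _⊓_; _≤_; _<_; z≤n; s≤s; s≤s⁻¹; _<ᵇ_)
open import Data.Nat.Properties hiding (*-identityˡ)
open import Data.Product.Base using (∃; _×_; _,_; proj₁; proj₂)
open import Data.Sum.Base using (inj₁; inj₂)
open import Data.Vec.Base using (Vec; []; _∷_; here; tabulate; insertAt)
open import Data.Vec.Properties using (tabulate-cong; ∷-injectiveˡ; ∷-injectiveʳ)
open import Function.Base using (_∘_; id)
open import Relation.Binary.PropositionalEquality using (_≡_; _≢_; refl; sym; trans; cong; cong₂; subst)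
open import Relation.Nullary.Decidable using (Dec; yes; no; ⌊_⌋; recompute)
open import Relation.Nullary.Negation using (contradiction)

private
  variable
    n m r s : ℕ
    A B : Set

-- Numbers of ones in initial segments of 0,1-sequences.

onesUpTo : ℕ → Vec Bool n → ℕ
onesUpTo zero    v           = 0
onesUpTo (suc k) []          = 0
onesUpTo (suc k) (true  ∷ v) = suc (onesUpTo k v)
onesUpTo (suc k) (false ∷ v) = onesUpTo k v

-- At the first place where two sequences differ, their counts differ too. This lets rank sequences
-- be compared through the ranks of initial segments of orderings.
onesUpTo-injective : (v w : Vec Bool n) →
  (∀ k → k ≤ n → onesUpTo k v ≡ onesUpTo k w) → v ≡ w
onesUpTo-injective [] [] eq = refl
onesUpTo-injective (true  ∷ v) (true  ∷ w) eq =
  cong (true ∷_) (onesUpTo-injective v w λ k k≤n → suc-injective (eq (suc k) (s≤s k≤n)))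
onesUpTo-injective (false ∷ v) (false ∷ w) eq =
  cong (false ∷_) (onesUpTo-injective v w λ k k≤n → eq (suc k) (s≤s k≤n))
onesUpTo-injective (true  ∷ v) (false ∷ w) eq = contradiction (eq 1 (s≤s z≤n)) λ ()
onesUpTo-injective (false ∷ v) (true  ∷ w) eq = contradiction (eq 1 (s≤s z≤n)) λ ()

onesUpTo≤∣∣ : ∀ k (v : Vec Bool n) → onesUpTo k v ≤ ∣ v ∣
onesUpTo≤∣∣ zero    v           = z≤n
onesUpTo≤∣∣ (suc k) []          = z≤n
onesUpTo≤∣∣ (suc k) (true  ∷ v) = s≤s (onesUpTo≤∣∣ k v)
onesUpTo≤∣∣ (suc k) (false ∷ v) = onesUpTo≤∣∣ k v

onesUpTo≤ : ∀ k (v : Vec Bool n) → onesUpTo k v ≤ k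
onesUpTo≤ zero    v           = z≤n
onesUpTo≤ (suc k) []          = z≤n
onesUpTo≤ (suc k) (true  ∷ v) = s≤s (onesUpTo≤ k v)
onesUpTo≤ (suc k) (false ∷ v) = m≤n⇒m≤1+n (onesUpTo≤ k v)

-- Segments reaching the right-most 1 contain all `∣ v ∣` ones and lose one; shorter ones contain at
-- most `pred ∣ v ∣` and are unchanged. If `v` has no 1, both sides are 0.
onesUpTo-lastOneToZero : ∀ k (v : Vec Bool n) →
  onesUpTo k (lastOneToZero v) ≡ pred ∣ v ∣ ⊓ onesUpTo k v
onesUpTo-lastOneToZero zero    v  = sym (⊓-zeroʳ (pred ∣ v ∣))
onesUpTo-lastOneToZero (suc k) [] = refl
onesUpTo-lastOneToZero (suc k) (b ∷ v) with ∣ v ∣ in eq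
onesUpTo-lastOneToZero (suc k) (b ∷ v) | zero
  with onesUpTo k v | n≤0⇒n≡0 (≤-trans (onesUpTo≤∣∣ k v) (≤-reflexive eq))
onesUpTo-lastOneToZero (suc k) (true  ∷ v) | zero | _ | refl = refl
onesUpTo-lastOneToZero (suc k) (false ∷ v) | zero | _ | refl = refl
onesUpTo-lastOneToZero (suc k) (true  ∷ v) | suc m =
  cong suc (trans (onesUpTo-lastOneToZero k v) (cong (λ c → pred c ⊓ onesUpTo k v) eq))
onesUpTo-lastOneToZero (suc k) (false ∷ v) | suc m =
  trans (onesUpTo-lastOneToZero k v) (cong (λ c → pred c ⊓ onesUpTo k v) eq)

-- A segment of ones only has count `k` and is unchanged; a segment containing a 0 has count below
-- `k` and gains one. Past the end of `v` counts stop growing while `k` does not, hence the bound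
-- `k ≤ n`.
onesUpTo-firstZeroToOne : ∀ k (v : Vec Bool n) → k ≤ n →
  onesUpTo k (firstZeroToOne v) ≡ k ⊓ suc (onesUpTo k v)
onesUpTo-firstZeroToOne zero    v           k≤n = refl
onesUpTo-firstZeroToOne (suc k) (true  ∷ v) k<n =
  cong suc (onesUpTo-firstZeroToOne k v (s≤s⁻¹ k<n))
onesUpTo-firstZeroToOne (suc k) (false ∷ v) k<n =
  cong suc (sym (m≥n⇒m⊓n≡n (onesUpTo≤ k v)))

onesUpTo-insertAt-≤ : ∀ {k} (v : Vec Bool n) i b → k ≤ toℕ i →
  onesUpTo k (insertAt v i b) ≡ onesUpTo k v
onesUpTo-insertAt-≤ {k = zero}  v           i       b k≤i       = refl
onesUpTo-insertAt-≤ {k = suc k} (true  ∷ v) (suc i) b (s≤s k≤i) =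
  cong suc (onesUpTo-insertAt-≤ v i b k≤i)
onesUpTo-insertAt-≤ {k = suc k} (false ∷ v) (suc i) b (s≤s k≤i) =
  onesUpTo-insertAt-≤ v i b k≤i

-- A count does not depend on the order of the bits counted, so once the inserted bit lies in the
-- segment it may be moved to the front.
onesUpTo-insertAt-> : ∀ {k} (v : Vec Bool n) i b → toℕ i ≤ k →
  onesUpTo (suc k) (insertAt v i b) ≡ onesUpTo (suc k) (b ∷ v)
onesUpTo-insertAt-> v           zero    b     i≤k       = refl
onesUpTo-insertAt-> (true  ∷ v) (suc i) true  (s≤s i≤k) = cong suc (onesUpTo-insertAt-> v i true i≤k)
onesUpTo-insertAt-> (true  ∷ v) (suc i) false (s≤s i≤k) = cong suc (onesUpTo-insertAt-> v i false i≤k)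
onesUpTo-insertAt-> (false ∷ v) (suc i) true  (s≤s i≤k) = onesUpTo-insertAt-> v i true i≤k
onesUpTo-insertAt-> (false ∷ v) (suc i) false (s≤s i≤k) = onesUpTo-insertAt-> v i false i≤k

-- The increments telescope, and the two bounds make each of them 0 or 1, so `bit` loses nothing.
-- The summand `f 0` is there because the induction passes to `f ∘ suc`, which starts at `f 1`.
onesUpTo-increments : ∀ n (f : ℕ → ℕ) →
  (∀ (i : Fin n) → f (toℕ i) ≤ f (suc (toℕ i))) →
  (∀ (i : Fin n) → f (suc (toℕ i)) ≤ suc (f (toℕ i))) →
  ∀ k → k ≤ n →
  onesUpTo k (tabulate {n = n} (λ i → bit (f (suc (toℕ i)) ∸ f (toℕ i)))) + f 0 ≡ f k
onesUpTo-increments n       f lo hi zero    k≤n = refl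
onesUpTo-increments (suc n) f lo hi (suc k) (s≤s k≤n)
  with m≤n⇒m<n∨m≡n (lo zero) | onesUpTo-increments n (f ∘ suc) (lo ∘ suc) (hi ∘ suc) k k≤n
... | inj₂ eq | ih rewrite sym eq | n∸n≡0 (f 0) = ih
... | inj₁ lt | ih rewrite ≤-antisym (hi zero) lt | m+n∸n≡m 1 (f 0) = trans (sym (+-suc _ (f 0))) ih

onesUpTo-rankBits : ∀ (M : Matroid n r) π {k} → k ≤ n →
  onesUpTo k (rankBits M π) ≡ Matroid.rank M (prefix π k)
onesUpTo-rankBits {n} M π {k} k≤n = trans (sym (+-identityʳ _))
  (trans (cong (onesUpTo k (rankBits M π) +_) (sym (trans (cong rank (prefix-zero π)) rank-⊥)))
         (onesUpTo-increments n (rank ∘ prefix π)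
           (λ i → rank-mono (prefix-suc⊇ π (toℕ i)))
           (λ i → rank-step (π ⟨$⟩ʳ i) (prefix-suc⊆ π i)) k k≤n))
  where open Matroid M

-- Initial segments of an ordering with a new element inserted.

punchIn-<ᵇ-≤ : ∀ {k} (i : Fin (suc n)) j → k ≤ toℕ i → (toℕ (punchIn i j) <ᵇ k) ≡ (toℕ j <ᵇ k)
punchIn-<ᵇ-≤ {k = zero}  i       j       k≤i       = refl
punchIn-<ᵇ-≤ {k = suc k} (suc i) zero    (s≤s k≤i) = refl
punchIn-<ᵇ-≤ {k = suc k} (suc i) (suc j) (s≤s k≤i) = punchIn-<ᵇ-≤ i j k≤i

punchIn-<ᵇ-> : ∀ {k} (i : Fin (suc n)) j → toℕ i ≤ k → (toℕ (punchIn i j) <ᵇ suc k) ≡ (toℕ j <ᵇ k)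
punchIn-<ᵇ-> zero    j       i≤k       = refl
punchIn-<ᵇ-> (suc i) zero    (s≤s i≤k) = refl
punchIn-<ᵇ-> (suc i) (suc j) (s≤s i≤k) = punchIn-<ᵇ-> i j i≤k

≤⇒<ᵇ-false : ∀ {m n} → n ≤ m → (m <ᵇ n) ≡ false
≤⇒<ᵇ-false z≤n     = refl
≤⇒<ᵇ-false (s≤s p) = ≤⇒<ᵇ-false p

prefix-insert-≤ : ∀ i (π : Permutation′ n) {k} → k ≤ toℕ i →
  prefix (Perm.insert i zero π) k ≡ outside ∷ prefix π k
prefix-insert-≤ i π k≤i = cong₂ _∷_ (≤⇒<ᵇ-false k≤i)
  (tabulate-cong λ e → punchIn-<ᵇ-≤ i (π ⟨$⟩ˡ e) k≤i)

-- The new element takes one of the first `suc k` places, which leaves `k` of them to `π`.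
prefix-insert-> : ∀ i (π : Permutation′ n) {k} → toℕ i ≤ k →
  prefix (Perm.insert i zero π) (suc k) ≡ inside ∷ prefix π k
prefix-insert-> i π i≤k = cong₂ _∷_ (T⇒≡true (<⇒<ᵇ (s≤s i≤k)))
  (tabulate-cong λ e → punchIn-<ᵇ-> i (π ⟨$⟩ˡ e) i≤k)

-- Each step adds exactly one element, which is new because its position is not among the earlier
-- ones. This turns the bound `∣ S ∣` on ranks in `M ×x` into the length of a segment.
∣prefix∣ : ∀ (π : Permutation′ n) k → k ≤ n → ∣ prefix π k ∣ ≡ k
∣prefix∣ {n} π zero    k≤n = trans (cong ∣_∣ (prefix-zero π)) (∣⊥∣≡0 n)
-- Replacing `k` by `toℕ i` makes it possible to name the element added, `π ⟨$⟩ʳ i`.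
∣prefix∣ {n} π (suc k) k<n with fromℕ< k<n | Fin.toℕ-fromℕ< k<n
... | i | refl = trans (≤-antisym
    (≤-trans (p⊆q⇒∣p∣≤∣q∣ (prefix-suc⊆ π i)) (∣p∪⁅x⁆∣≤1+∣p∣ (prefix π (toℕ i)) (π ⟨$⟩ʳ i)))
    (p⊂q⇒∣p∣<∣q∣ (prefix-suc⊇ π (toℕ i) , π ⟨$⟩ʳ i , ∈-prefix⁺ π (suc (toℕ i)) (s≤s (≤-reflexive i≡)) ,
      λ ∈p → <-irrefl i≡ (∈-prefix⁻ π (toℕ i) ∈p))))
  (cong suc (∣prefix∣ π (toℕ i) (<⇒≤ k<n)))
  where
  i≡ : toℕ (π ⟨$⟩ˡ (π ⟨$⟩ʳ i)) ≡ toℕ i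
  i≡ = cong toℕ (inverseˡ π)

-- Ranks in the free extension.

∣p-x∣+1 : ∀ (p : Subset n) {x} → x ∈ p → suc ∣ p - x ∣ ≡ ∣ p ∣
∣p-x∣+1 p {x} x∈p = ≤-antisym (x∈p⇒∣p-x∣<∣p∣ x∈p) (∣p∣≤1+∣p-x∣ p x)

module _ (M : Matroid n r) where
  open Matroid M

  rank-least : ∀ {S k} → (∀ I → Independent I → I ⊆ S → ∣ I ∣ ≤ k) → rank S ≤ k
  rank-least {S} bound with rank-attained S
  ... | I , iI , I⊆S , eq = subst (_≤ _) eq (bound I iI I⊆S)

∣b∷p∣≤1+∣p∣ : ∀ b (p : Subset n) → ∣ b ∷ p ∣ ≤ suc ∣ p ∣
∣b∷p∣≤1+∣p∣ true  p = ≤-refl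
∣b∷p∣≤1+∣p∣ false p = n≤1+n ∣ p ∣

module _ (M : Matroid n r) where
  open Matroid M
  open Matroid (M +x) using () renaming
    (Independent to Independent⁺; rank to rank⁺; rank-upper to rank⁺-upper)

  independent-+x-outside⁺ : ∀ {I} → Independent I → Independent⁺ (outside ∷ I)
  independent-+x-outside⁺ (B , bB , I⊆B) = outside ∷ B , bB , out⊆ I⊆B

  -- A basis `B` containing `I` has an element `y` outside `I`. Then `B - y` is independent of size
  -- one less than `r`, so it is a basis of a copoint, and it still contains `I`.
  independent-+x-inside⁺ : ∀ {I} → Independent I → ∣ I ∣ < r → Independent⁺ (inside ∷ I)
  independent-+x-inside⁺ {I} iI@(B , bB , I⊆B) I<r
    with augment iI (basis⇒independent bB) (subst (∣ I ∣ <_) (sym (∣basis∣ bB)) I<r)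
  ... | y , y∈B , y∉I , _ = inside ∷ (B - y) ,
    basisOfCopoint⁺ (independent-⊆ (p─q⊆p B ⁅ y ⁆) (basis⇒independent bB))
                    (trans (∣p-x∣+1 B y∈B) (∣basis∣ bB)) ,
    s⊆s λ x∈I → x∈p∧x≢y⇒x∈p-y (I⊆B x∈I) λ { refl → y∉I x∈I }

  independent-+x⁻ : ∀ {b I} → Independent⁺ (b ∷ I) → Independent I
  independent-+x⁻ (outside ∷ B , bB , I⊆B) = B , bB , drop-∷-⊆ I⊆B
  independent-+x⁻ (inside ∷ B , (_ , cF , bB) , I⊆B) =
    independent-⊆ (drop-∷-⊆ I⊆B) (proj₁ (basisOfCopoint⁻ cF bB))

  rank-+x-outside : ∀ S → rank⁺ (outside ∷ S) ≡ rank S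
  rank-+x-outside S = ≤-antisym (rank-least (M +x) upper) (rank-least M lower)
    where
    upper : ∀ I → Independent⁺ I → I ⊆ outside ∷ S → ∣ I ∣ ≤ rank S
    upper (inside  ∷ I) iI I⊆S = contradiction (I⊆S here) λ ()
    upper (outside ∷ I) iI I⊆S = rank-upper (independent-+x⁻ iI) (drop-∷-⊆ I⊆S)
    lower : ∀ I → Independent I → I ⊆ S → ∣ I ∣ ≤ rank⁺ (outside ∷ S)
    lower I iI I⊆S = rank⁺-upper (independent-+x-outside⁺ iI) (s⊆s I⊆S)

  -- One more element raises the rank by at most 1. Conversely, a largest independent subset `I` of
  -- `S` can be enlarged by x if `∣ I ∣ < r`, and otherwise already has the full size `r`.
  rank-+x-inside : ∀ S → rank⁺ (inside ∷ S) ≡ r ⊓ suc (rank S)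
  rank-+x-inside S = ≤-antisym
    (⊓-glb (Matroid.rank≤r (M +x) (inside ∷ S)) upper)
    (lower (rank-attained S))
    where
    upper : rank⁺ (inside ∷ S) ≤ suc (rank S)
    -- The singleton of `zero` is `inside ∷ ⊥`, so adding it to `outside ∷ S` gives
    -- `inside ∷ (S ∪ ⊥)`.
    upper = ≤-trans (Matroid.rank-step (M +x) zero (s⊆s (p⊆p∪q ⊥)))
                    (s≤s (≤-reflexive (rank-+x-outside S)))
    lower′ : ∀ {I} → Independent I → I ⊆ S → Dec (∣ I ∣ < r) → r ⊓ suc ∣ I ∣ ≤ rank⁺ (inside ∷ S)
    lower′ {I} iI I⊆S (yes I<r) = ≤-trans (m⊓n≤n r (suc ∣ I ∣))
      (rank⁺-upper (independent-+x-inside⁺ iI I<r) (s⊆s I⊆S))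
    lower′ {I} iI I⊆S (no  I≮r) = ≤-trans (m⊓n≤m r (suc ∣ I ∣)) (≤-trans (≮⇒≥ I≮r)
      (rank⁺-upper (independent-+x-outside⁺ iI) (out⊆ I⊆S)))
    lower : (∃ λ I → Independent I × I ⊆ S × ∣ I ∣ ≡ rank S) → r ⊓ suc (rank S) ≤ rank⁺ (inside ∷ S)
    lower (I , iI , I⊆S , eq) = subst (λ k → r ⊓ suc k ≤ rank⁺ (inside ∷ S)) eq (lower′ iI I⊆S (∣ I ∣ <? r))

  -- Bases and ranks in the free coextension.

  open Matroid (M ×x) using () renaming
    ( Basis to Basisˣ; Independent to Independentˣ; rank to rankˣ
    ; rank-upper to rankˣ-upper)

  -- The complement of `inside ∷ B` avoids x, so it is a basis of `M *ᴹ +x` exactly when `∁ B` is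
  -- one of `M *ᴹ`; only a double complement remains.
  basis-×x-inside⁺ : ∀ {B} → Basis B → Basisˣ (inside ∷ B)
  basis-×x-inside⁺ {B} = subst Basis (sym (∁-involutive B))

  basis-×x-inside⁻ : ∀ {B} → Basisˣ (inside ∷ B) → Basis B
  basis-×x-inside⁻ {B} = subst Basis (∁-involutive B)

  -- The complement contains x, so `∁ (B ∪ ⁅ y ⁆)` has to be a basis of a copoint of the dual. It
  -- lies in the dual basis `∁ B` and is smaller by one element.
  basis-×x-outside⁺ : ∀ {B y} → Basis B → y ∉ B → Basisˣ (outside ∷ (B ∪ ⁅ y ⁆))
  basis-×x-outside⁺ {B} {y} bB y∉B = Matroid.basisOfCopoint⁺ (M *ᴹ)
    (∁ B , subst Basis (sym (∁-involutive B)) bB , p⊆q⇒∁p⊇∁q (p⊆p∪q ⁅ y ⁆)) size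
    where
    open ≤-Reasoning
    ∣B∪y∣ : ∣ B ∪ ⁅ y ⁆ ∣ ≡ suc r
    ∣B∪y∣ = trans (x∉p⇒∣p∪⁅x⁆∣≡1+∣p∣ B y y∉B) (cong suc (∣basis∣ bB))
    size : suc ∣ ∁ (B ∪ ⁅ y ⁆) ∣ ≡ n ∸ r
    size = begin-equality
      suc ∣ ∁ (B ∪ ⁅ y ⁆) ∣   ≡⟨ cong suc (∣∁p∣≡n∸∣p∣ (B ∪ ⁅ y ⁆)) ⟩
      -- The bound `∣p∣≤n` ensures that the subtraction is not truncated; afterwards `suc n ∸ suc r`
      -- computes to `n ∸ r`.
      suc (n ∸ ∣ B ∪ ⁅ y ⁆ ∣) ≡⟨ +-∸-assoc 1 (∣p∣≤n (B ∪ ⁅ y ⁆)) ⟨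
      suc n ∸ ∣ B ∪ ⁅ y ⁆ ∣   ≡⟨ cong (suc n ∸_) ∣B∪y∣ ⟩
      n ∸ r                   ∎

  basis-×x-outside⁻ : ∀ {B} → Basisˣ (outside ∷ B) → ∃ λ C → Basis C × C ⊆ B
  basis-×x-outside⁻ {B} (_ , cF , bB) with Matroid.basisOfCopoint⁻ (M *ᴹ) cF bB
  ... | (D , bD , ∁B⊆D) , _ = ∁ D , bD , subst (∁ D ⊆_) (∁-involutive B) (p⊆q⇒∁p⊇∁q ∁B⊆D)

  -- Every basis of `M ×x` is a basis of `M` with one element added, either x or an element of `E`.
  -- So an independent set of `M ×x` is independent in `M` after removal of at most one element.
  ∣independent-×x∣≤ : ∀ {b I S} → Independentˣ (b ∷ I) → I ⊆ S → ∣ b ∷ I ∣ ≤ suc (rank S)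
  ∣independent-×x∣≤ {b} {I} (inside ∷ B , bB , I⊆B) I⊆S = ≤-trans (∣b∷p∣≤1+∣p∣ b I)
    (s≤s (rank-upper (B , basis-×x-inside⁻ bB , drop-∷-⊆ I⊆B) I⊆S))
  ∣independent-×x∣≤ {inside} (outside ∷ B , bB , I⊆B) I⊆S = contradiction (I⊆B here) λ ()
  ∣independent-×x∣≤ {outside} {I} {S} (outside ∷ B , bB , I⊆B) I⊆S with basis-×x-outside⁻ bB
  ... | C , bC , C⊆B = begin
    ∣ I ∣                          ≤⟨ p⊆q⇒∣p∣≤∣q∣ cover ⟩
    ∣ (B ─ C) ∪ (I ∩ C) ∣          ≤⟨ ∣p∪q∣≤∣p∣+∣q∣ (B ─ C) (I ∩ C) ⟩
    ∣ B ─ C ∣ + ∣ I ∩ C ∣          ≤⟨ +-mono-≤ ∣B─C∣≤1 (rank-upper (C , bC , p∩q⊆q I C) (I⊆S ∘ p∩q⊆p I C)) ⟩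
    suc (rank S)                   ∎
    where
    open ≤-Reasoning
    cover : I ⊆ (B ─ C) ∪ (I ∩ C)
    cover {e} e∈I with e ∈? C
    ... | yes e∈C = q⊆p∪q (B ─ C) (I ∩ C) (x∈p∩q⁺ (e∈I , e∈C))
    ... | no  e∉C = p⊆p∪q (I ∩ C) (x∈p∧x∉q⇒x∈p─q (drop-∷-⊆ I⊆B e∈I) e∉C)
    ∣B─C∣≤1 : ∣ B ─ C ∣ ≤ 1
    ∣B─C∣≤1 = +-cancelʳ-≤ r ∣ B ─ C ∣ 1 (begin
      ∣ B ─ C ∣ + r     ≡⟨ cong (∣ B ─ C ∣ +_) (∣basis∣ bC) ⟨
      ∣ B ─ C ∣ + ∣ C ∣ ≤⟨ ∣p─q∣+∣q∣≤∣p∣ B C C⊆B ⟩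
      ∣ B ∣             ≡⟨ Matroid.∣basis∣ (M ×x) {outside ∷ B} bB ⟩
      suc r             ∎)

  -- A largest independent subset of `S` lies in some basis `B`, and `inside ∷ B` is a basis of
  -- `M ×x`; so x can always be added to it.
  rank-×x-inside : ∀ S → rankˣ (inside ∷ S) ≡ suc (rank S)
  rank-×x-inside S = ≤-antisym (rank-least (M ×x) upper) (lower (rank-attained S))
    where
    upper : ∀ I → Independentˣ I → I ⊆ inside ∷ S → ∣ I ∣ ≤ suc (rank S)
    upper (_ ∷ I) iI I⊆S = ∣independent-×x∣≤ iI (drop-∷-⊆ I⊆S)
    lower : (∃ λ I → Independent I × I ⊆ S × ∣ I ∣ ≡ rank S) → suc (rank S) ≤ rankˣ (inside ∷ S)
    lower (I , (B , bB , I⊆B) , I⊆S , eq) = subst (λ k → suc k ≤ rankˣ (inside ∷ S)) eq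
      (rankˣ-upper (inside ∷ B , basis-×x-inside⁺ bB , s⊆s I⊆B) (s⊆s I⊆S))

  -- Let `J` be a largest independent subset of `S`, inside a basis `B`. If `J` is all of `S`, then
  -- `S` lies in the basis `inside ∷ B`. Otherwise any `y` in `S ─ J` can be added to `J`, within
  -- the basis `outside ∷ (B ∪ ⁅ y ⁆)`.
  rank-×x-outside : ∀ S → rankˣ (outside ∷ S) ≡ ∣ S ∣ ⊓ suc (rank S)
  rank-×x-outside S = ≤-antisym (rank-least (M ×x) upper) (lower (rank-attained S))
    where
    upper : ∀ I → Independentˣ I → I ⊆ outside ∷ S → ∣ I ∣ ≤ ∣ S ∣ ⊓ suc (rank S)
    upper (inside  ∷ I) iI I⊆S = contradiction (I⊆S here) λ ()
    upper (outside ∷ I) iI I⊆S =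
      ⊓-glb (p⊆q⇒∣p∣≤∣q∣ (drop-∷-⊆ I⊆S)) (∣independent-×x∣≤ iI (drop-∷-⊆ I⊆S))

    lower′ : ∀ {J} → Independent J → J ⊆ S → ∣ J ∣ ≡ rank S → Dec (Nonempty (S ─ J)) →
             ∣ S ∣ ⊓ suc (rank S) ≤ rankˣ (outside ∷ S)
    lower′ {J} (B , bB , J⊆B) J⊆S eq (no empty) = ≤-trans (m⊓n≤m ∣ S ∣ (suc (rank S)))
      (rankˣ-upper (inside ∷ B , basis-×x-inside⁺ bB , out⊆ (J⊆B ∘ S⊆J)) ⊆-refl)
      where
      S⊆J : S ⊆ J
      S⊆J {e} e∈S with e ∈? J
      ... | yes e∈J = e∈J
      ... | no  e∉J = contradiction (e , x∈p∧x∉q⇒x∈p─q e∈S e∉J) empty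
    lower′ {J} (B , bB , J⊆B) J⊆S eq (yes (y , y∈)) = ≤-trans (m⊓n≤n ∣ S ∣ (suc (rank S)))
      (subst (_≤ rankˣ (outside ∷ S)) ∣J∪y∣
        (rankˣ-upper {I = outside ∷ (J ∪ ⁅ y ⁆)}
          (outside ∷ (B ∪ ⁅ y ⁆) , basis-×x-outside⁺ bB y∉B ,
            s⊆s (∪⁅⁆-least (p⊆p∪q ⁅ y ⁆ ∘ J⊆B) (y∈p∪⁅y⁆ B y)))
          (s⊆s J∪y⊆S)))
      where
      y∉J   = proj₂ (x∈p─q⁻ S J y∈)
      J∪y⊆S : J ∪ ⁅ y ⁆ ⊆ S
      J∪y⊆S = ∪⁅⁆-least J⊆S (proj₁ (x∈p─q⁻ S J y∈))
      ∣J∪y∣ : ∣ J ∪ ⁅ y ⁆ ∣ ≡ suc (rank S)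
      ∣J∪y∣ = trans (x∉p⇒∣p∪⁅x⁆∣≡1+∣p∣ J y y∉J) (cong suc eq)
      -- Otherwise J ∪ y would be an independent subset of S larger than J.
      y∉B : y ∉ B
      y∉B y∈B = <-irrefl refl (subst (_≤ rank S) ∣J∪y∣
        (rank-upper (B , bB , ∪⁅⁆-least J⊆B y∈B) J∪y⊆S))

    lower : (∃ λ J → Independent J × J ⊆ S × ∣ J ∣ ≡ rank S) →
            ∣ S ∣ ⊓ suc (rank S) ≤ rankˣ (outside ∷ S)
    lower (J , iJ , J⊆S , eq) = lower′ iJ J⊆S eq (nonempty? (S ─ J))

-- Rank sequences of orderings with x inserted.

by-insertion-position : ∀ (i : Fin (suc n)) {P : ℕ → Set} →
  (∀ k → k ≤ toℕ i → k ≤ n → P k) →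
  (∀ k → toℕ i ≤ k → k ≤ n → P (suc k)) →
  ∀ k → k ≤ suc n → P k
by-insertion-position i before after k k≤1+n with k ≤? toℕ i
... | yes k≤i = before k k≤i (≤-trans k≤i (s≤s⁻¹ (Fin.toℕ<n i)))
by-insertion-position i before after zero    k≤1+n | no k≰i = contradiction z≤n k≰i
by-insertion-position i before after (suc k) k≤1+n | no k≰i = after k (s≤s⁻¹ (≰⇒> k≰i)) (s≤s⁻¹ k≤1+n)

module _ (M : Matroid n r) (i : Fin (suc n)) (π : Permutation′ n) where
  open Matroid M using (rank)

  private
    π′ = Perm.insert i zero π

  onesUpTo-insert-≤ : ∀ {k} b → k ≤ toℕ i → k ≤ n →
    onesUpTo k (insertAt (rankBits M π) i b) ≡ rank (prefix π k)
  onesUpTo-insert-≤ b k≤i k≤n =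
    trans (onesUpTo-insertAt-≤ (rankBits M π) i b k≤i) (onesUpTo-rankBits M π k≤n)

  rankBits-+x : rankBits (M +x) π′ ≡ lastOneToZero (insertAt (rankBits M π) i true)
  rankBits-+x = onesUpTo-injective _ _ λ k k≤1+n →
    trans (onesUpTo-rankBits (M +x) π′ k≤1+n)
      (trans (by-insertion-position i before after k k≤1+n)
        -- Since `v` has `suc r` ones, the cap `pred ∣ v ∣` is `r`.
        (sym (trans (onesUpTo-lastOneToZero k v) (cong (λ c → pred c ⊓ onesUpTo k v) ∣v∣))))
    where
    v : Vec Bool (suc n)
    v = insertAt (rankBits M π) i true
    ∣v∣ : ∣ v ∣ ≡ suc r
    ∣v∣ = trans (insertAt-1-count (rankBits M π) i) (cong suc (rankBits-count M π))

    before : ∀ k → k ≤ toℕ i → k ≤ n → Matroid.rank (M +x) (prefix π′ k) ≡ r ⊓ onesUpTo k v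
    before k k≤i k≤n =
      trans (cong (Matroid.rank (M +x)) (prefix-insert-≤ i π k≤i))
      (trans (rank-+x-outside M (prefix π k))
      -- Before x appears the rank is that in `M`, and capping it at `r` changes nothing.
      (trans (sym (m≥n⇒m⊓n≡n (Matroid.rank≤r M (prefix π k))))
             (cong (r ⊓_) (sym (onesUpTo-insert-≤ true k≤i k≤n)))))

    after : ∀ k → toℕ i ≤ k → k ≤ n → Matroid.rank (M +x) (prefix π′ (suc k)) ≡ r ⊓ onesUpTo (suc k) v
    after k i≤k k≤n =
      trans (cong (Matroid.rank (M +x)) (prefix-insert-> i π i≤k))
      (trans (rank-+x-inside M (prefix π k))
             (cong (r ⊓_) (sym (trans (onesUpTo-insertAt-> (rankBits M π) i true i≤k)
                                      (cong suc (onesUpTo-rankBits M π k≤n))))))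

  rankBits-×x : rankBits (M ×x) π′ ≡ firstZeroToOne (insertAt (rankBits M π) i false)
  rankBits-×x = onesUpTo-injective _ _ λ k k≤1+n →
    trans (onesUpTo-rankBits (M ×x) π′ k≤1+n)
      (trans (by-insertion-position i before after k k≤1+n)
        (sym (onesUpTo-firstZeroToOne k v k≤1+n)))
    where
    v : Vec Bool (suc n)
    v = insertAt (rankBits M π) i false

    before : ∀ k → k ≤ toℕ i → k ≤ n → Matroid.rank (M ×x) (prefix π′ k) ≡ k ⊓ suc (onesUpTo k v)
    before k k≤i k≤n =
      trans (cong (Matroid.rank (M ×x)) (prefix-insert-≤ i π k≤i))
      (trans (rank-×x-outside M (prefix π k))
             (cong₂ (λ a b → a ⊓ suc b) (∣prefix∣ π k k≤n) (sym (onesUpTo-insert-≤ false k≤i k≤n))))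

    after : ∀ k → toℕ i ≤ k → k ≤ n →
      Matroid.rank (M ×x) (prefix π′ (suc k)) ≡ suc k ⊓ suc (onesUpTo (suc k) v)
    after k i≤k k≤n =
      trans (cong (Matroid.rank (M ×x)) (prefix-insert-> i π i≤k))
      (trans (rank-×x-inside M (prefix π k))
      (trans (cong suc (sym (onesUpTo-rankBits M π k≤n)))
      -- The first `k` bits contain at most `k` ones, so the minimum with `suc k` may be introduced;
      -- it computes under `suc`.
      (trans (cong suc (sym (m≥n⇒m⊓n≡n (onesUpTo≤ k (rankBits M π)))))
             (cong (λ c → suc k ⊓ suc c) (sym (onesUpTo-insertAt-> (rankBits M π) i false i≤k))))))

-- Symbols, finite sums and specializations.

bits-injective : {s t : Seq n r} → bits s ≡ bits t → s ≡ t
-- The field `ones` is irrelevant, so by eta the bits determine the sequence.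
bits-injective refl = refl

toSeq-bits : (s : Seq n r) → toSeq r (bits s) ≡ just s
toSeq-bits {r = r} (mkSeq v p) with ∣ v ∣ ≟ r
... | yes _ = refl
... | no ¬p = contradiction (recompute (∣ v ∣ ≟ r) p) ¬p


module GInvariantProperties {c ℓ₁ ℓ₂} (K : HeytingField c ℓ₁ ℓ₂) where
  open HeytingField K using (1#; 0#; heytingCommutativeRing)
  open CommutativeRing (HeytingCommutativeRing.commutativeRing heytingCommutativeRing)
    using (+-commutativeMonoid; *-identityˡ; zeroˡ; distribʳ)
  open GInvariant K

  module _ {n r : ℕ} where
    open CommutativeMonoid (Pointwise.commutativeMonoid (Seq n r) +-commutativeMonoid) public
      using (commutativeSemigroup)
      renaming ( reflexive to ≡⇒≋; refl to ≋-refl; sym to ≋-sym; trans to ≋-trans; ∙-cong to ⊕-cong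
               ; ∙-congˡ to ⊕-congˡ
               ; assoc to ⊕-assoc; identityˡ to ⊕-identityˡ; identityʳ to ⊕-identityʳ)
    open CommutativeSemigroupProperties commutativeSemigroup public
      using () renaming (interchange to ⊕-interchange)

  ∑-cong : ∀ xs {f g : A → 𝒢-space n r} → (∀ x → f x ≋ g x) → ∑ xs f ≋ ∑ xs g
  ∑-cong []       f≋g = ≋-refl
  ∑-cong (x ∷ xs) f≋g = ⊕-cong (f≋g x) (∑-cong xs f≋g)

  ∑-𝟎 : ∀ xs {f : A → 𝒢-space n r} → (∀ x → f x ≋ 𝟎) → ∑ xs f ≋ 𝟎
  ∑-𝟎 []       f≋𝟎 = ≋-refl
  ∑-𝟎 (x ∷ xs) f≋𝟎 = ≋-trans (⊕-cong (f≋𝟎 x) (∑-𝟎 xs f≋𝟎)) (⊕-identityˡ 𝟎)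

  ∑-⊕ : ∀ xs (f g : A → 𝒢-space n r) → ∑ xs (λ x → f x ⊕ g x) ≋ ∑ xs f ⊕ ∑ xs g
  ∑-⊕ []       f g = ≋-sym (⊕-identityˡ 𝟎)
  ∑-⊕ (x ∷ xs) f g = ≋-trans (⊕-congˡ (∑-⊕ xs f g))
    (⊕-interchange (f x) (g x) (∑ xs f) (∑ xs g))

  ∑-++ : ∀ xs ys (f : A → 𝒢-space n r) → ∑ (xs ++ ys) f ≋ ∑ xs f ⊕ ∑ ys f
  ∑-++ []       ys f = ≋-sym (⊕-identityˡ (∑ ys f))
  ∑-++ (x ∷ xs) ys f = ≋-trans (⊕-congˡ (∑-++ xs ys f))
    (≋-sym (⊕-assoc (f x) (∑ xs f) (∑ ys f)))

  ∑-map : ∀ (g : A → B) xs (f : B → 𝒢-space n r) → ∑ (map g xs) f ≡ ∑ xs (f ∘ g)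
  ∑-map g xs f = List.foldr-map _ g 𝟎 xs

  ∑-concatMap : ∀ (g : A → List B) xs (f : B → 𝒢-space n r) →
    ∑ (concatMap g xs) f ≋ ∑ xs (λ x → ∑ (g x) f)
  ∑-concatMap g []       f = ≋-refl
  ∑-concatMap g (x ∷ xs) f = ≋-trans (∑-++ (g x) (concatMap g xs) f)
    (⊕-congˡ (∑-concatMap g xs f))

  ∑-mapMaybe : ∀ (g : A → Maybe B) xs (f : B → 𝒢-space n r) →
    ∑ (mapMaybe g xs) f ≋ ∑ xs (λ x → maybe′ f 𝟎 (g x))
  ∑-mapMaybe g []       f = ≋-refl
  ∑-mapMaybe g (x ∷ xs) f with g x
  ... | just y  = ⊕-congˡ (∑-mapMaybe g xs f)
  ... | nothing = ≋-trans (∑-mapMaybe g xs f) (≋-sym (⊕-identityˡ _))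

  -- `subsets` lists each subset once: of its two halves, only the one with the first bit of `v`
  -- contributes, and induction applies there.
  ∑-subsets-single : ∀ (v : Subset m) (f : Subset m → 𝒢-space n r) →
    (∀ w → w ≢ v → f w ≋ 𝟎) → ∑ (subsets m) f ≋ f v
  ∑-subsets-single []      f off = ⊕-identityʳ (f [])
  ∑-subsets-single {m = suc m} (b ∷ v) f off =
    ≋-trans (∑-++ (map (false ∷_) (subsets m)) (map (true ∷_) (subsets m)) f) (both b off)
    where
    half : ∀ {y b} → (∀ w → w ≢ b ∷ v → f w ≋ 𝟎) →
           ∑ (map (y ∷_) (subsets m)) f ≋ (if ⌊ y ≟ᵇ b ⌋ then f (b ∷ v) else 𝟎)
    half {y} {b} off rewrite ∑-map (y ∷_) (subsets m) f with y ≟ᵇ b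
    ... | yes refl = ∑-subsets-single v (f ∘ (y ∷_)) λ w w≢v → off (y ∷ w) (w≢v ∘ ∷-injectiveʳ)
    ... | no  y≢b  = ∑-𝟎 (subsets m) λ w → off (y ∷ w) (y≢b ∘ ∷-injectiveˡ)

    both : ∀ b → (∀ w → w ≢ b ∷ v → f w ≋ 𝟎) →
      ∑ (map (false ∷_) (subsets m)) f ⊕ ∑ (map (true ∷_) (subsets m)) f ≋ f (b ∷ v)
    both false off = ≋-trans (⊕-cong (half off) (half off)) (⊕-identityʳ (f (false ∷ v)))
    both true  off = ≋-trans (⊕-cong (half off) (half off)) (⊕-identityˡ (f (true ∷ v)))

  symbol-same : ∀ (s : Seq n r) → [ s ] s ≡ 1#
  symbol-same s with s ≟ˢ s
  ... | yes _  = refl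
  ... | no s≢s = contradiction refl s≢s

  symbol-other : ∀ (s : Seq n r) {t} → s ≢ t → [ s ] t ≡ 0#
  symbol-other s {t} s≢t with s ≟ˢ t
  ... | yes s≡t = contradiction s≡t s≢t
  ... | no  _   = refl

  module _ {n r m s : ℕ} (f : Seq n r → 𝒢-space m s) where

    specialize-𝟎 : specialize f 𝟎 ≋ 𝟎
    specialize-𝟎 = ∑-𝟎 (seqs n r) λ t x → zeroˡ (f t x)

    specialize-⊕ : ∀ u v → specialize f (u ⊕ v) ≋ specialize f u ⊕ specialize f v
    specialize-⊕ u v = ≋-trans
      (∑-cong (seqs n r) λ t x → distribʳ (f t x) (u t) (v t))
      (∑-⊕ (seqs n r) (λ t → u t · f t) (λ t → v t · f t))

    specialize-∑ : ∀ xs (u : A → 𝒢-space n r) →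
      specialize f (∑ xs u) ≋ ∑ xs (λ x → specialize f (u x))
    specialize-∑ []       u = specialize-𝟎
    specialize-∑ (x ∷ xs) u = ≋-trans (specialize-⊕ (u x) (∑ xs u)) (⊕-congˡ (specialize-∑ xs u))

    specialize-[] : ∀ t → specialize f [ t ] ≋ f t
    -- `seqs` omits the subsets with a wrong number of ones. Giving these the value `𝟎` turns the
    -- sum into one over all subsets, to which only `bits t` contributes.
    specialize-[] t = ≋-trans (∑-mapMaybe (toSeq r) (subsets n) term)
      (≋-trans (∑-subsets-single (bits t) (maybe′ term 𝟎 ∘ toSeq r) off) on)
      where
      term : Seq n r → 𝒢-space m s
      term u = [ t ] u · f u

      off : ∀ w → w ≢ bits t → maybe′ term 𝟎 (toSeq r w) ≋ 𝟎
      off w w≢ x with ∣ w ∣ ≟ r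
      ... | yes p rewrite symbol-other t {mkSeq w p} (λ { refl → w≢ refl }) = zeroˡ (f (mkSeq w p) x)
      ... | no  _ = ≋-refl {m} {s} {𝟎} x

      on : maybe′ term 𝟎 (toSeq r (bits t)) ≋ f t
      on x rewrite toSeq-bits t | symbol-same t = *-identityˡ (f t x)

  -- The list `permutations (suc n)` runs through all insertions of `zero` into the orderings `π` of
  -- the other elements, so `𝒢 N` is a double sum. For fixed `π`, the sum over positions is the
  -- value assigned to the symbol of `π`, and linearity gives the sum over `π`. Leaving `q` and `f`
  -- open covers extension and coextension alike.
  𝒢-by-insertion : ∀ {q} (M : Matroid n r) (N : Matroid (suc n) q)
    (f : Fin (suc n) → Seq n r → Seq (suc n) q) →
    (∀ i π → rankSeq N (Perm.insert i zero π) ≡ f i (rankSeq M π)) →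
    𝒢 N ≋ specialize (λ s → [ f zero s ] ⊕ ∑ (allFin n) (λ j → [ f (suc j) s ])) (𝒢 M)
  𝒢-by-insertion {n = n} {r = r} {q = q} M N f rankSeq-insert = ≋-trans
    (∑-concatMap (λ π → map (λ i → Perm.insert i zero π) (allFin (suc n))) (permutations n)
                 (λ ρ → [ rankSeq N ρ ]))
    (≋-trans (∑-cong (permutations n) inner)
             (≋-sym (specialize-∑ g (permutations n) (λ π → [ rankSeq M π ]))))
    where
    g : Seq n r → 𝒢-space (suc n) q
    g s = [ f zero s ] ⊕ ∑ (allFin n) (λ j → [ f (suc j) s ])

    inner : ∀ π → ∑ (map (λ i → Perm.insert i zero π) (allFin (suc n))) (λ ρ → [ rankSeq N ρ ])
                  ≋ specialize g [ rankSeq M π ]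
    inner π = ≋-trans
      (≡⇒≋ (∑-map (λ i → Perm.insert i zero π) (allFin (suc n)) (λ ρ → [ rankSeq N ρ ])))
      (≋-trans (∑-cong (allFin (suc n)) λ i → ≡⇒≋ (cong [_] (rankSeq-insert i π)))
      (≋-trans (⊕-congˡ (≡⇒≋ tail))
               (≋-sym (specialize-[] g (rankSeq M π)))))
      where
      h : Fin (suc n) → 𝒢-space (suc n) q
      h i = [ f i (rankSeq M π) ]

      -- Position `zero` splits off by computation and is the separate first term of `g`; the
      -- remaining positions have to be reindexed by `allFin n`.
      tail : ∑ (List.tabulate {n = n} suc) h ≡ ∑ (allFin n) (h ∘ suc)
      tail = trans (cong (λ is → ∑ is h) (sym (List.map-tabulate {n = n} id suc)))
                   (∑-map suc (allFin n) h)

proposition4p9 : ∀ {c ℓ₁ ℓ₂} (K : HeytingField c ℓ₁ ℓ₂) → CharacteristicZero K →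
    let open GInvariant K in
    ∀ {n r : ℕ} (M : Matroid n r) →
    (𝒢 (M +x) ≋ specialize (λ s → [ insert1 zero s ↓ ] ⊕ ∑ (allFin n) (λ j → [ insert1 (suc j) s ↓ ])) (𝒢 M))
    ×
    (𝒢 (M ×x) ≋ specialize (λ s → [ insert0 zero s ↑⟨ r<1+n s ⟩ ] ⊕ ∑ (allFin n) (λ j → [ insert0 (suc j) s ↑⟨ r<1+n s ⟩ ])) (𝒢 M))
proposition4p9 K _ M =
    𝒢-by-insertion M (M +x) (λ i s → insert1 i s ↓)
      (λ i π → bits-injective (rankBits-+x M i π))
  , 𝒢-by-insertion M (M ×x) (λ i s → insert0 i s ↑⟨ r<1+n s ⟩)
      (λ i π → bits-injective (rankBits-×x M i π))
  where open GInvariantProperties K
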